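{- Let $G$ be any connected graph. If $T_{\mathrm{NT}} \subseteq G$ is a normal tree such that every component of $G - T_{\mathrm{NT}}$ has finite neighbourhood, then $G$ has a rooted tree-decomposition $(T, \mathcal{V})$ with the following three properties: - its separators are upwards disjoint, finite and connected; - $(T, \mathcal{V})$ displays the undominated ends of $G$ that lie in the closure of $V(T_{\mathrm{NT}})$; - $(T, \mathcal{V})$ covers $V(T_{\mathrm{NT}})$ cofinally.
   Context: Graphs may be infinite. A rooted tree $T_{\mathrm{NT}}\subseteq G$ is normal in $G$ if the endvertices of every $T_{\mathrm{NT}}$-path in $G$ are comparable in its tree-order. The neighbourhood of a component $C$ of $G-T_{\mathrm{NT}}$ is the set of vertices outside $C$ adjacent to $C$. A comb is the union of a ray $R$ (its spine) with infinitely many disjoint finite paths, possibly trivial, having precisely their first vertex on $R$; their last vertices are the teeth; a comb attached to $W$ has all teeth in $W$. An end of $G$ is an equivalence class of rays, two rays being equivalent if no finite vertex set separates them; an end $\omega$ lies in the closure of a vertex set $W$ if $G$ contains a comb attached to $W$ with spine in $\omega$. A vertex $v$ dominates a ray $R$ if there are infinitely many $v$–$(R-v)$ paths pairwise meeting only in $v$; an end is undominated if its rays are dominated by no vertex. For a tree-decomposition $(T,(V_t)_{t\in T})$ the separator associated with an edge $t_1t_2$ is $V_{t_1}\cap V_{t_2}$, connected if it induces a connected subgraph. In a rooted tree-decomposition (root $r$, tree-order on $T$) the separators are upwards disjoint if any two distinct edges $e,f$ with $e$ on the path from $r$ to $f$ have disjoint separators. If all separators are finite, each end $\omega$ of $G$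 orients each edge $t_1t_2$ of $T$ towards that component of $T-t_1t_2$ whose parts (minus the separator) contain tails of the rays of $\omega$; either all edges point to a unique node ($\omega$ lives there) or to a unique end $\eta$ of $T$ ($\omega$ corresponds to $\eta$); write $\tau(\omega)$ for this node or end. The decomposition displays a set $\Psi$ of ends if $\tau$ restricts to a bijection from $\Psi$ onto the set of ends of $T$ and maps every end not in $\Psi$ to a node of $T$. A rooted tree-decomposition covers a vertex set $W$ cofinally if every node of $T$ lies below (in the tree-order) some node whose part meets $W$. -}

module Defs where

open import Level using (0ℓ)
open import Data.Nat using (ℕ; zero; suc; _≤_; _<_)
open import Data.Product using (Σ; _×_; _,_)
open import Data.Sum using (_⊎_)
open import Data.Unit using (⊤)
open import Data.List using (List; []; _∷_; _++_)
open import Data.List.Relation.Unary.Linked using (Linked)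
open import Data.List.Relation.Unary.Unique.Propositional using (Unique)
open import Data.List.Relation.Unary.All using (All)
open import Data.List.Membership.Propositional using (_∈_; _∉_)
open import Relation.Nullary using (¬_)
open import Relation.Binary.PropositionalEquality using (_≡_; _≢_)

lastOr : {A : Set} → A → List A → A
lastOr x []       = x
lastOr x (y ∷ ys) = lastOr y ys

iter : {A : Set} → (A → A) → ℕ → A → A
iter f zero    a = a
iter f (suc k) a = f (iter f k a)

record Graph : Set₁ where
  field
    V      : Set
    _~_    : V → V → Set
    ~-sym  : ∀ {u v} → u ~ v → v ~ u
    ~-irr  : ∀ {v} → ¬ (v ~ v)

module GraphNotions {V : Set} (_~_ : V → V → Set) where

  Finite : (V → Set) → Set
  Finite X = Σ (List V) λ xs → ∀ v → X v → v ∈ xs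

  record Path : Set where
    constructor mkPath
    field
      start  : V
      rest   : List V
      linked : Linked _~_ (start ∷ rest)
      unique : Unique (start ∷ rest)

  verts : Path → List V
  verts p = Path.start p ∷ Path.rest p

  end : Path → V
  end p = lastOr (Path.start p) (Path.rest p)

  ConnectedSet : (V → Set) → Set
  ConnectedSet X =
    Σ V X ×
    (∀ u v → X u → X v →
      Σ Path λ p → Path.start p ≡ u × end p ≡ v × All X (verts p))

  Connected : Set
  Connected = ConnectedSet (λ _ → ⊤)

  IsComponent : (V → Set) → (V → Set) → Set
  IsComponent S C =
    Σ V C ×
    (∀ v → C v → ¬ S v) ×
    (∀ u v → C u → C v →
      Σ Path λ p → Path.start p ≡ u × end p ≡ v × All C (verts p)) ×
    (∀ u w → C u → u ~ w → ¬ S w → C w)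

  Nbhd : (V → Set) → V → Set
  Nbhd C v = ¬ C v × Σ V λ c → C c × c ~ v

  record Ray : Set where
    constructor mkRay
    field
      at  : ℕ → V
      inj : ∀ m n → at m ≡ at n → m ≡ n
      adj : ∀ n → at n ~ at (suc n)

  open Ray public

  HasTail : Ray → (V → Set) → Set
  HasTail R U = Σ ℕ λ n → ∀ m → n ≤ m → U (at R m)

  -- R₁, R₂ are equivalent: no finite vertex set X separates them, i.e.
  -- for every finite X (given as a list) they have tails in the same component of G - X
  RayEquiv : Ray → Ray → Set
  RayEquiv R₁ R₂ =
    ∀ (X : List V) →
    Σ ℕ λ n → Σ ℕ λ m →
      (∀ k → n ≤ k → at R₁ k ∉ X) ×
      (∀ k → m ≤ k → at R₂ k ∉ X) ×
      (Σ Path λ p → Path.start p ≡ at R₁ n × end p ≡ at R₂ m ×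
                    All (λ v → v ∉ X) (verts p))

  record Comb (W : V → Set) : Set where
    field
      spine    : Ray
      foot     : ℕ → ℕ
      tl       : ℕ → List V
      linkedP  : ∀ i → Linked _~_ (at spine (foot i) ∷ tl i)
      uniqueP  : ∀ i → Unique (at spine (foot i) ∷ tl i)
      offSpine : ∀ i → All (λ v → ∀ n → v ≢ at spine n) (tl i)
      disjoint : ∀ i j → i ≢ j → ∀ v →
                   v ∈ (at spine (foot i) ∷ tl i) →
                   v ∉ (at spine (foot j) ∷ tl j)
      teeth    : ∀ i → W (lastOr (at spine (foot i)) (tl i))

  -- the end of R lies in the closure of W
  InClosure : (V → Set) → Ray → Set
  InClosure W R = Σ (Comb W) λ C → RayEquiv (Comb.spine C) R

  Dominates : V → Ray → Set
  Dominates v R =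
    Σ (ℕ → List V) λ mid → Σ (ℕ → ℕ) λ hit →
      (∀ i → Linked _~_ (v ∷ mid i ++ at R (hit i) ∷ [])) ×
      (∀ i → Unique (v ∷ mid i ++ at R (hit i) ∷ [])) ×
      (∀ i → at R (hit i) ≢ v) ×
      (∀ i → All (λ u → ∀ n → u ≢ at R n) (mid i)) ×
      (∀ i j → i ≢ j → ∀ u →
         u ∈ (mid i ++ at R (hit i) ∷ []) →
         u ∉ (mid j ++ at R (hit j) ∷ []))

  Undominated : Ray → Set
  Undominated R = ∀ R' → RayEquiv R R' → ∀ v → ¬ Dominates v R'

record RootedSubtree (G : Graph) : Set₁ where
  open Graph G
  field
    inT    : V → Set
    root   : V
    parent : V → V
    height : V → ℕ
    root∈  : inT root
    root-h : height root ≡ 0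
    h0     : ∀ v → inT v → height v ≡ 0 → v ≡ root
    step   : ∀ v n → inT v → height v ≡ suc n →
               inT (parent v) × (parent v ~ v) × height (parent v) ≡ n

  _≤T_ : V → V → Set
  u ≤T v = inT v × Σ ℕ λ k → k ≤ height v × iter parent k v ≡ u

IsNormal : (G : Graph) → RootedSubtree G → Set
IsNormal G T =
  ∀ u ms v → inT u → inT v → All (λ w → ¬ inT w) ms →
    Linked _~_ (u ∷ ms ++ v ∷ []) → Unique (u ∷ ms ++ v ∷ []) →
    (u ≤T v) ⊎ (v ≤T u)
  where open Graph G
        open RootedSubtree T

record TreeDecomp (G : Graph) : Set₁ where
  open Graph G
  field
    N       : Set
    root    : N
    parent  : N → N
    height  : N → ℕ
    root-h  : height root ≡ 0
    h0      : ∀ t → height t ≡ 0 → t ≡ root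
    step    : ∀ t n → height t ≡ suc n → height (parent t) ≡ n
    Part    : N → V → Set

  _≤T_ : N → N → Set
  s ≤T t = Σ ℕ λ k → k ≤ height t × iter parent k t ≡ s

  OnPath : N → N → N → Set
  OnPath t₁ t₃ t₂ =
    (t₂ ≤T t₁ ⊎ t₂ ≤T t₃) × (∀ s → s ≤T t₁ → s ≤T t₃ → s ≤T t₂)

  _~N_ : N → N → Set
  s ~N t = (0 < height t × parent t ≡ s) ⊎ (0 < height s × parent s ≡ t)

  field
    cover-v : ∀ v → Σ N λ t → Part t v
    cover-e : ∀ u v → u ~ v → Σ N λ t → Part t u × Part t v
    coh     : ∀ t₁ t₂ t₃ v → OnPath t₁ t₃ t₂ →
                Part t₁ v → Part t₃ v → Part t₂ v

  -- the edge of T below a non-root node t is  t (parent t);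
  -- its separator:
  Sep : N → V → Set
  Sep t v = Part t v × Part (parent t) v

module _ (G : Graph) (D : TreeDecomp G) where
  open Graph G
  open TreeDecomp D
  open GraphNotions _~_
  module TN = GraphNotions _~N_

  SepsUpDisjoint : Set
  SepsUpDisjoint =
    ∀ s t → 0 < height s → 0 < height t → s ≢ t → s ≤T t →
      ∀ v → Sep s v → ¬ Sep t v

  SepsFinite : Set
  SepsFinite = ∀ t → 0 < height t → Finite (Sep t)

  SepsConnected : Set
  SepsConnected = ∀ t → 0 < height t → ConnectedSet (Sep t)

  UpSide : N → V → Set
  UpSide t v = (Σ N λ s → t ≤T s × Part s v) × ¬ Sep t v

  DownSide : N → V → Set
  DownSide t v = (Σ N λ s → ¬ (t ≤T s) × Part s v) × ¬ Sep t v

  -- orientation of the edge below t by (the end of) R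
  PointsUp PointsDown : Ray → N → Set
  PointsUp R t   = HasTail R (UpSide t)
  PointsDown R t = HasTail R (DownSide t)

  -- τ(end of R) = node u
  LivesAt : Ray → N → Set
  LivesAt R u = ∀ t → 0 < height t →
    (t ≤T u → PointsUp R t) × (¬ (t ≤T u) → PointsDown R t)

  -- τ(end of R) = end of T containing the ray η of T
  CorrespondsTo : Ray → TN.Ray → Set
  CorrespondsTo R η = ∀ t → 0 < height t →
    (TN.HasTail η (λ s → t ≤T s) → PointsUp R t) ×
    (TN.HasTail η (λ s → ¬ (t ≤T s)) → PointsDown R t)

  -- D displays the set of ends Ψ (given as a predicate on rays,
  -- invariant under ray-equivalence)
  Displays : (Ray → Set) → Set
  Displays Ψ =
    (∀ R → Ψ R → Σ TN.Ray λ η → CorrespondsTo R η) ×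
    (∀ R → ¬ Ψ R → Σ N λ u → LivesAt R u) ×
    (∀ R₁ R₂ η₁ η₂ → Ψ R₁ → Ψ R₂ →
       CorrespondsTo R₁ η₁ → CorrespondsTo R₂ η₂ →
       TN.RayEquiv η₁ η₂ → RayEquiv R₁ R₂) ×
    (∀ η → Σ Ray λ R → Ψ R × CorrespondsTo R η)

  CoversCofinally : (V → Set) → Set
  CoversCofinally W = ∀ t → Σ N λ s → t ≤T s × Σ V λ v → Part s v × W v

{-# OPTIONS --safe #-}

-- For a vertex t of the normal tree let A t, the cone of t, be the up-closure of t
-- together with all components attached to it. By normality the neighbours of A t
-- lie strictly below t on a chain. Along each branch select vertices greedily: the
-- root, and then t as soon as all neighbours of A t lie above the last selected
-- vertex s. The selected vertices form the decomposition tree, and the separator of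
-- the edge st is the whole interval [s,t) of the normal tree: it is finite and
-- connected, and intervals further up are disjoint from it.
-- A ray R of G is eventually inside or outside each cone. If the selected cones
-- containing a tail of R are unbounded, R lies in the closure of the tree, and it is
-- undominated because the disjoint separators cut any vertex off from R. Conversely,
-- if R is in the closure but only finitely many selected cones contain a tail of it,
-- then by the greedy rule every later cone on its branch has a neighbour below the
-- last selected vertex; by pigeonhole one vertex is adjacent to all of them, and it
-- dominates the branch. So the rays of the decomposition tree correspond to the
-- undominated ends in the closure.
module Submission where

open import Defs
open import Level using (0ℓ)
open import Axiom.ExcludedMiddle using (ExcludedMiddle)
open import Data.Empty using (⊥-elim)
open import Data.List using (List; []; _∷_; _++_; map; upTo; filter)
open import Data.List.Extrema.Nat using (argmax; argmax-all; f[xs]≤f[argmax])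
open import Data.List.Membership.Propositional using (_∈_; _∉_)
open import Data.List.Membership.Propositional.Properties
  using (∈-map⁺; ∈-upTo⁺; ∈-++⁺ˡ; ∈-++⁺ʳ; ∈-filter⁺)
open import Data.List.Relation.Unary.All using (All; []; _∷_)
import Data.List.Relation.Unary.All as All
import Data.List.Relation.Unary.All.Properties as AllP
open import Data.List.Relation.Unary.AllPairs using ([]; _∷_)
import Data.List.Relation.Unary.AllPairs as AllPairs
import Data.List.Relation.Unary.AllPairs.Properties as AllPairsP
open import Data.List.Relation.Unary.Any using (here; there)
open import Data.List.Relation.Unary.Linked using (Linked; [-]; _∷_)
import Data.List.Relation.Unary.Linked as Linked
open import Data.List.Relation.Unary.Unique.Propositional using (Unique)
open import Data.Nat
  using (ℕ; zero; suc; _+_; _≤_; _<_; z≤n; s≤s; _⊔_; _∸_; s≤s⁻¹)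
open import Data.Nat.Properties
open import Data.Product using (Σ; _×_; _,_; proj₁; proj₂)
open import Data.Sum using (_⊎_; inj₁; inj₂; [_,_]′)
open import Data.Bool.Properties using (T-irrelevant)
open import Data.Unit using (⊤; tt)
open import Relation.Binary.Construct.Closure.ReflexiveTransitive
  using (Star; ε; _◅_; _◅◅_; reverse)
import Relation.Binary.Construct.Closure.ReflexiveTransitive as Star
open import Relation.Binary.PropositionalEquality
  using (_≡_; _≢_; refl; sym; trans; cong; subst; subst₂)
open import Relation.Nullary using (¬_; Dec; yes; no)
open import Relation.Nullary.Decidable
  using (True; toWitness; fromWitness; decidable-stable)

-- Preliminaries: natural numbers and pigeonhole arguments.

0<⇒≡suc : ∀ {n} → 0 < n → Σ ℕ λ m → n ≡ suc m
0<⇒≡suc (s≤s _) = _ , refl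

≤-step-invariant : (P : ℕ → Set) (n : ℕ) → P n →
  (∀ k → n ≤ k → P k → P (suc k)) → ∀ m → n ≤ m → P m
≤-step-invariant P n p s m n≤m = subst P (m∸n+n≡m n≤m) (go (m ∸ n))
  where
  go : ∀ k → P (k + n)
  go zero    = p
  go (suc k) = s (k + n) (m≤n+m n k) (go k)

module Classical (em : ExcludedMiddle 0ℓ) where

  byContradiction : {P : Set} → ¬ ¬ P → P
  byContradiction = decidable-stable em

  counterexample : {A : Set} {P : A → Set} → ¬ (∀ a → P a) → Σ A λ a → ¬ P a
  counterexample ¬∀ =
    byContradiction λ ¬∃ → ¬∀ λ a → byContradiction λ ¬p → ¬∃ (a , ¬p)

  -- Each element of `X` lies in at most one of the disjoint lists, so only finitely many lists meet
  -- `X`.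
  disjoint-avoids : {A : Set} (L : ℕ → List A) →
    (∀ i j → i ≢ j → ∀ v → v ∈ L i → v ∉ L j) →
    ∀ X → Σ ℕ λ n → ∀ i → n ≤ i → ∀ v → v ∈ X → v ∉ L i
  disjoint-avoids L disj []      = 0 , λ _ _ _ ()
  disjoint-avoids L disj (x ∷ X) with disjoint-avoids L disj X | em {Σ ℕ λ j → x ∈ L j}
  ... | n , av | no ∄ = n , λ where
    i n≤i v (here refl) v∈ → ∄ (i , v∈)
    i n≤i v (there v∈X)    → av i n≤i v v∈X
  ... | n , av | yes (j , x∈) = n ⊔ suc j , λ where
    i le v (here refl) v∈ →
      disj j i (<⇒≢ (m⊔n≤o⇒n≤o n (suc j) le)) v x∈ v∈
    i le v (there v∈X)    → av i (m⊔n≤o⇒m≤o n (suc j) le) v v∈X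

  -- An element that works for no `k` from some `n` on is dropped from the list after shifting the
  -- index by `n`.
  infinite-pigeonhole : {A : Set} (P : A → ℕ → Set) (X : List A) →
    (∀ k → Σ A λ a → a ∈ X × P a k) →
    Σ A λ a → a ∈ X × ∀ n → Σ ℕ λ k → n ≤ k × P a k
  infinite-pigeonhole P [] h with h 0
  ... | _ , () , _
  infinite-pigeonhole P (x ∷ X) h with em {∀ n → Σ ℕ λ k → n ≤ k × P x k}
  ... | yes inf = x , here refl , inf
  ... | no fin with counterexample fin
  ...   | n , none = a , there a∈ , λ m → let k , m≤k , p = inf m in
      n + k , ≤-trans m≤k (m≤n+m k n) , p
    where
    later : ∀ k → Σ _ λ a → a ∈ X × P a (n + k)
    later k with h (n + k)
    ... | _ , here refl , p = ⊥-elim (none (n + k , m≤m+n n k , p))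
    ... | a , there a∈  , p = a , a∈ , p
    rest = infinite-pigeonhole (λ a k → P a (n + k)) X later
    a    = proj₁ rest
    a∈   = proj₁ (proj₂ rest)
    inf  = proj₂ (proj₂ rest)

-- Walks, paths and rays in a symmetric graph.

module Walks (em : ExcludedMiddle 0ℓ) {A : Set} (_~_ : A → A → Set)
  (~-sym : ∀ {u v} → u ~ v → v ~ u) where
  open Classical em
  open GraphNotions _~_

  Walk : (A → Set) → A → A → Set
  Walk P = Star λ a b → P a × P b × a ~ b

  Joined : (A → Set) → A → A → Set
  Joined P u v =
    Σ Path λ p → Path.start p ≡ u × end p ≡ v × All P (verts p)

  lastOr-snoc : ∀ (a : A) xs y → lastOr a (xs ++ y ∷ []) ≡ y
  lastOr-snoc a []       y = refl
  lastOr-snoc a (x ∷ xs) y = lastOr-snoc x xs y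

  walk-rev : ∀ {P a b} → Walk P a b → Walk P b a
  walk-rev = reverse λ (p , q , e) → q , p , ~-sym e

  walk-map : ∀ {P Q : A → Set} → (∀ {x} → P x → Q x) →
    ∀ {a b} → Walk P a b → Walk Q a b
  walk-map f = Star.map λ (p , q , e) → f p , f q , e

  walk-invariant : ∀ {P I : A → Set} →
    (∀ {a b} → P a → P b → a ~ b → I a → I b) →
    ∀ {a b} → Walk P a b → I a → I b
  walk-invariant f ε                 i = i
  walk-invariant f ((p , q , e) ◅ w) i = walk-invariant f w (f p q e i)

  suffix : ∀ {P c} a xs → Linked _~_ (a ∷ xs) → Unique (a ∷ xs) →
    All P (a ∷ xs) → c ∈ a ∷ xs → Joined P c (lastOr a xs)
  suffix a xs       l u al (here refl) = mkPath a xs l u , refl , refl , al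
  suffix a (x ∷ xs) l u al (there c∈)  =
    suffix x xs (Linked.tail l) (AllPairs.tail u) (All.tail al) c∈

  -- Loops are cut out from the back: if the new start already occurs on the simplified rest, the
  -- path begins at that occurrence.
  walk⇒joined : ∀ {P a b} → P a → Walk P a b → Joined P a b
  walk⇒joined pa ε = mkPath _ [] [-] ([] ∷ []) , refl , refl , pa ∷ []
  walk⇒joined {a = a} pa ((_ , pb , e) ◅ w) with walk⇒joined pb w
  ... | mkPath b xs l u , refl , refl , al with em {a ∈ b ∷ xs}
  ...   | yes a∈ = suffix b xs l u al a∈
  ...   | no  a∉ =
    mkPath a (b ∷ xs) (e ∷ l) (AllP.¬Any⇒All¬ _ a∉ ∷ u) , refl , refl , pa ∷ al

  list⇒walk : ∀ {P} a xs → Linked _~_ (a ∷ xs) → All P (a ∷ xs) →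
    Walk P a (lastOr a xs)
  list⇒walk a []       _       _              = ε
  list⇒walk a (x ∷ xs) (e ∷ l) (pa ∷ px ∷ al) =
    (pa , px , e) ◅ list⇒walk x xs l (px ∷ al)

  joined⇒walk : ∀ {P a b} → Joined P a b → Walk P a b
  joined⇒walk (mkPath a xs l _ , refl , refl , al) = list⇒walk a xs l al

  linked-snoc : ∀ {y} a xs → Linked _~_ (a ∷ xs) → lastOr a xs ~ y →
    Linked _~_ (a ∷ xs ++ y ∷ [])
  linked-snoc a []       _       e = e ∷ [-]
  linked-snoc a (x ∷ xs) (d ∷ l) e = d ∷ linked-snoc x xs l e

  unique-snoc : ∀ {y : A} {xs} → Unique xs → All (_≢ y) xs →
    Unique (xs ++ y ∷ [])
  unique-snoc u ≢y = AllPairsP.++⁺ u ([] ∷ []) (All.map (λ n → n ∷ []) ≢y)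

  -- The ends fail `P` while the interior satisfies it, so no vertex repeats. Normality and
  -- domination speak of paths of this form.
  walk⇒linkingPath : ∀ {P : A → Set} {x a c y} → x ~ a → P a → Walk P a c → c ~ y →
    ¬ P x → ¬ P y → x ≢ y →
    Σ (List A) λ ms → All P ms × Linked _~_ (x ∷ ms ++ y ∷ []) ×
      Unique (x ∷ ms ++ y ∷ [])
  walk⇒linkingPath {P} d pa w e ¬px ¬py x≢y with walk⇒joined pa w
  ... | mkPath a xs l u , refl , refl , al =
    a ∷ xs , al , d ∷ linked-snoc a xs l e ,
    AllP.++⁺ (All.map (λ { p refl → ¬px p }) al) (x≢y ∷ []) ∷
    unique-snoc u (All.map (λ { p refl → ¬py p }) al)

  firstHit : ∀ {P Q : A → Set} {a b} → Walk P a b → ¬ Q a → Q b →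
    Σ A λ c → Σ A λ d →
      Walk (λ x → P x × ¬ Q x) a c × (P c × ¬ Q c) × c ~ d × P d × Q d
  firstHit ε ¬qa qa = ⊥-elim (¬qa qa)
  firstHit {Q = Q} {a = a} (_◅_ {j = b} (pa , pb , e) w) ¬qa qz with em {Q b}
  ... | yes qb = a , b , ε , (pa , ¬qa) , e , pb , qb
  ... | no ¬qb with firstHit w ¬qb qz
  ...   | c , d , w' , rest = c , d , ((pa , ¬qa) , (pb , ¬qb) , e) ◅ w' , rest

  ray-avoids : ∀ R (X : List A) → Σ ℕ λ n → ∀ k → n ≤ k → at R k ∉ X
  ray-avoids R X with disjoint-avoids (λ i → at R i ∷ [])
      (λ { i j i≢j v (here refl) (here e) → i≢j (inj R i j e) }) X
  ... | n , av = n , λ k n≤k k∈ → av k n≤k _ k∈ (here refl)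

  ray-invariant : ∀ {P I : A → Set} →
    (∀ {a b} → P a → P b → a ~ b → I a → I b) → ∀ R n →
    (∀ k → n ≤ k → P (at R k)) → I (at R n) → ∀ m → n ≤ m → I (at R m)
  ray-invariant {I = I} f R n p i = ≤-step-invariant (λ k → I (at R k)) n i
    λ k n≤k → f (p k n≤k) (p (suc k) (m≤n⇒m≤1+n n≤k)) (adj R k)

  ray-invariant⁻ : ∀ {P I : A → Set} →
    (∀ {a b} → P a → P b → a ~ b → I a → I b) → ∀ R n →
    (∀ k → n ≤ k → P (at R k)) → ∀ m → n ≤ m → I (at R m) → I (at R n)
  ray-invariant⁻ {I = I} f R n p = ≤-step-invariant (λ k → I (at R k) → I (at R n))
    n (λ i → i) λ k n≤k back i →
      back (f (p (suc k) (m≤n⇒m≤1+n n≤k)) (p k n≤k) (~-sym (adj R k)) i)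

  segment : Ray → ℕ → List A
  segment R n = map (at R) (upTo n)

  ∉segment⇒≥ : ∀ R {n m} → at R m ∉ segment R n → n ≤ m
  ∉segment⇒≥ R ∉s = ≮⇒≥ λ m<n → ∉s (∈-map⁺ (at R) (∈-upTo⁺ m<n))

  equiv-sym : ∀ {R R'} → RayEquiv R R' → RayEquiv R' R
  equiv-sym eq X with eq X
  ... | n , m , avR , avR' , p =
    m , n , avR' , avR ,
    walk⇒joined (avR' m ≤-refl) (walk-rev (joined⇒walk p))

  -- I is a side of a separation of the graph whose separator lies in X.
  module Side (I : A → Set) (X : List A)
    (inv : ∀ {a b} → a ∉ X → b ∉ X → a ~ b → I a → I b) where

    dichotomy : ∀ R → HasTail R I ⊎ HasTail R (λ v → ¬ I v × v ∉ X)
    dichotomy R with ray-avoids R X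
    ... | n , av with em {I (at R n)}
    ...   | yes i = inj₁ (n , ray-invariant inv R n av i)
    ...   | no ¬i = inj₂ (n , λ m n≤m →
      (λ i → ¬i (ray-invariant⁻ inv R n av m n≤m i)) , av m n≤m)

    -- Testing equivalence on `X` itself gives a connecting path that misses `X`, along which
    -- membership in `I` carries over.
    transfer : ∀ {R R'} → RayEquiv R R' → HasTail R I → HasTail R' I
    transfer {R} {R'} eq (k , up) with eq X
    ... | n , m , avR , avR' , p =
      m , ray-invariant inv R' m avR' (walk-invariant inv (joined⇒walk p)
        (ray-invariant⁻ inv R n avR (n ⊔ k) (m≤m⊔n n k) (up _ (m≤n⊔m n k))))

-- Tree-orders given by a parent map and a height.

module Tree {A : Set} (In : A → Set) (parent : A → A) (height : A → ℕ)
  (step : ∀ v → In v → 0 < height v →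
     In (parent v) × suc (height (parent v)) ≡ height v) where

  infix 4 _⊑_
  -- With `In` as `inT` this is the order of the normal tree, with `In` trivial that of the
  -- decomposition tree paired with `tt`. The bound on `k` keeps the iteration from passing the
  -- root, where `parent` is unconstrained.
  _⊑_ : A → A → Set
  u ⊑ v = In v × Σ ℕ λ k → k ≤ height v × iter parent k v ≡ u

  iter-+ : ∀ k l (v : A) → iter parent (k + l) v ≡ iter parent k (iter parent l v)
  iter-+ zero    l v = refl
  iter-+ (suc k) l v = cong parent (iter-+ k l v)

  iter-comm : ∀ k (v : A) → iter parent k (parent v) ≡ parent (iter parent k v)
  iter-comm zero    v = refl
  iter-comm (suc k) v = cong parent (iter-comm k v)

  mutual
    iter-In : ∀ k v → In v → k ≤ height v →
      In (iter parent k v) × k + height (iter parent k v) ≡ height v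
    iter-In zero    v i _   = i , refl
    iter-In (suc k) v i k<h =
      let j , e   = iter-In k v i (<⇒≤ k<h)
          j' , e' = step _ j (iter-pos k v i k<h)
      in j' , trans (sym (+-suc k _)) (trans (cong (k +_) e') e)

    iter-pos : ∀ k v → In v → k < height v → 0 < height (iter parent k v)
    iter-pos k v i k<h = +-cancelˡ-< k _ _
      (subst₂ _<_ (sym (+-identityʳ k)) (sym (proj₂ (iter-In k v i (<⇒≤ k<h)))) k<h)

  ⊑-In : ∀ {u v} → u ⊑ v → In u
  ⊑-In (i , k , k≤ , refl) = proj₁ (iter-In k _ i k≤)

  ⊑-height : ∀ {u v} → u ⊑ v → height u ≤ height v
  ⊑-height (i , k , k≤ , refl) =
    subst (height (iter parent k _) ≤_) (proj₂ (iter-In k _ i k≤)) (m≤n+m _ k)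

  ⊑-refl : ∀ {v} → In v → v ⊑ v
  ⊑-refl i = i , 0 , z≤n , refl

  ⊑-trans : ∀ {u v w} → u ⊑ v → v ⊑ w → u ⊑ w
  ⊑-trans {w = w} (_ , k , k≤ , refl) (i , l , l≤ , refl) =
    i , k + l ,
    subst (k + l ≤_) (trans (+-comm _ l) (proj₂ (iter-In l w i l≤))) (+-monoˡ-≤ l k≤) ,
    iter-+ k l w

  ⊑-height-≡ : ∀ {u v} → u ⊑ v → height u ≡ height v → u ≡ v
  ⊑-height-≡ (i , zero  , _  , refl) _ = refl
  ⊑-height-≡ {v = v} (i , suc k , k≤ , refl) e =
    ⊥-elim (<⇒≢ (subst (height (iter parent (suc k) v) <_)
      (proj₂ (iter-In (suc k) v i k≤)) (s≤s (m≤n+m _ k))) e)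

  ⊑-height-< : ∀ {u v} → u ⊑ v → u ≢ v → height u < height v
  ⊑-height-< u⊑v u≢v = ≤∧≢⇒< (⊑-height u⊑v) λ e → u≢v (⊑-height-≡ u⊑v e)

  ⊑-antisym : ∀ {u v} → u ⊑ v → v ⊑ u → u ≡ v
  ⊑-antisym p q = ⊑-height-≡ p (≤-antisym (⊑-height p) (⊑-height q))

  lower-by : ∀ k l w → In w → l + k ≤ height w → iter parent (l + k) w ⊑ iter parent k w
  lower-by k l w i le =
    let j , e = iter-In k w i (≤-trans (m≤n+m k l) le)
    in j , l , +-cancelˡ-≤ k _ _ (subst₂ _≤_ (+-comm l k) (sym e) le) ,
       sym (iter-+ l k w)

  -- Both are iterated parents of `w`; the one reached by more steps is an iterated parent of the
  -- other.
  ⊑-comparable : ∀ {u v w} → u ⊑ w → v ⊑ w → u ⊑ v ⊎ v ⊑ u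
  ⊑-comparable {w = w} (i , k , k≤ , refl) (_ , l , l≤ , refl) with ≤-total k l
  ... | inj₁ k≤l = inj₂ (subst (λ x → iter parent x w ⊑ iter parent k w) (m∸n+n≡m k≤l)
                    (lower-by k (l ∸ k) w i (subst (_≤ height w) (sym (m∸n+n≡m k≤l)) l≤)))
  ... | inj₂ l≤k = inj₁ (subst (λ x → iter parent x w ⊑ iter parent l w) (m∸n+n≡m l≤k)
                    (lower-by l (k ∸ l) w i (subst (_≤ height w) (sym (m∸n+n≡m l≤k)) k≤)))

  ⊑-of-comparable : ∀ {u v} → u ⊑ v ⊎ v ⊑ u → height u ≤ height v → u ⊑ v
  ⊑-of-comparable (inj₁ p) _ = p
  ⊑-of-comparable {v = v} (inj₂ p) h =
    subst (_⊑ v) (⊑-height-≡ p (≤-antisym (⊑-height p) h)) (⊑-refl (⊑-In p))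

  parent-⊑ : ∀ {v} → In v → 0 < height v → parent v ⊑ v
  parent-⊑ i h = i , 1 , h , refl

  ⊑-parent : ∀ {u v} → u ⊑ v → u ≢ v → 0 < height v × u ⊑ parent v
  ⊑-parent (i , zero  , _  , refl) u≢v = ⊥-elim (u≢v refl)
  ⊑-parent {v = v} (i , suc k , k≤ , refl) _ =
    let h≥1   = ≤-trans (s≤s z≤n) k≤
        j , e = step v i h≥1
    in h≥1 , j , k , s≤s⁻¹ (subst (suc k ≤_) (sym e) k≤) , iter-comm k v

  ancestorAt : ∀ {v} → In v → ∀ {h} → h ≤ height v → Σ A λ u → u ⊑ v × height u ≡ h
  ancestorAt {v} i {h} h≤ =
    let k = height v ∸ h
        _ , e = iter-In k v i (m∸n≤m (height v) h)
    in iter parent k v , (i , k , m∸n≤m (height v) h , refl) ,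
       +-cancelˡ-≡ k _ _ (trans e (sym (m∸n+n≡m h≤)))

  ancestors : A → List A
  ancestors v = map (λ k → iter parent k v) (upTo (suc (height v)))

  ⊑⇒∈ancestors : ∀ {u v} → u ⊑ v → u ∈ ancestors v
  ⊑⇒∈ancestors {v = v} (_ , k , k≤ , refl) =
    ∈-map⁺ (λ k → iter parent k v) (∈-upTo⁺ (s≤s k≤))

-- The normal tree and projections of the graph onto it.

module NormalTree (em : ExcludedMiddle 0ℓ) (G : Graph) (T : RootedSubtree G) where
  open Graph G
  open RootedSubtree T hiding (_≤T_)
  open Walks em _~_ ~-sym

  step⁺ : ∀ v → inT v → 0 < height v →
    inT (parent v) × suc (height (parent v)) ≡ height v
  step⁺ v i h with 0<⇒≡suc h
  ... | n , e = let j , _ , e' = step v n i e in j , trans (cong suc e') (sym e)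

  parent-~ : ∀ v → inT v → 0 < height v → parent v ~ v
  parent-~ v i h with 0<⇒≡suc h
  ... | n , e = proj₁ (proj₂ (step v n i e))

  open Tree inT parent height step⁺ public

  root-⊑ : ∀ {v} → inT v → root ⊑ v
  root-⊑ i with ancestorAt i z≤n
  ... | u , u⊑v , e = subst (_⊑ _) (h0 u (⊑-In u⊑v) e) u⊑v

  tree-induction : (P : V → Set) → P root →
    (∀ v → inT v → 0 < height v → P (parent v) → P v) → ∀ v → inT v → P v
  tree-induction P pr ps v i = go (height v) v i refl
    where
    go : ∀ n v → inT v → height v ≡ n → P v
    go zero    v i e = subst P (sym (h0 v i e)) pr
    go (suc n) v i e =
      let h       = subst (0 <_) (sym e) (s≤s z≤n)
          j , e'  = step⁺ v i h
      in ps v i h (go n (parent v) j (suc-injective (trans e' e)))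

  treeWalk : ∀ {u v} → u ⊑ v → Walk (λ x → u ⊑ x × x ⊑ v) v u
  treeWalk {v = v} (i , k , k≤ , refl) = go k k≤
    where
    go : ∀ k → k ≤ height v → Walk (λ x → iter parent k v ⊑ x × x ⊑ v) v (iter parent k v)
    go zero    _  = ε
    go (suc k) k< =
      walk-map (λ (p , q) → ⊑-trans last⊑ p , q) (go k (<⇒≤ k<)) ◅◅
      (((last⊑ , prev⊑) , (⊑-refl (⊑-In last⊑) , ⊑-trans last⊑ prev⊑) ,
        ~-sym (parent-~ _ (⊑-In prev⊑) (iter-pos k v i k<))) ◅ ε)
      where
      prev⊑ : iter parent k v ⊑ v
      prev⊑ = i , k , <⇒≤ k< , refl
      last⊑ : iter parent (suc k) v ⊑ iter parent k v
      last⊑ = parent-⊑ (⊑-In prev⊑) (iter-pos k v i k<)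

  -- The intended π sends a vertex of the tree to itself and a vertex of a component C
  -- of the complement to the highest neighbour of C, so {v | t ⊑ π v} is the up-closure
  -- of t together with all components attached to it.
  record Projection : Set where
    field
      π         : V → V
      π-In      : ∀ v → inT (π v)
      π-fixes   : ∀ {v} → inT v → π v ≡ v
      π-mono    : ∀ {u v} → u ~ v → ¬ inT v → π u ⊑ π v
      edge-comp : ∀ {u v} → u ~ v → inT u → inT v → u ⊑ v ⊎ v ⊑ u
      π-walk    : ∀ v → Walk (λ x → π x ≡ π v) v (π v)

module Decomposition (em : ExcludedMiddle 0ℓ) (G : Graph) (T : RootedSubtree G)
  (projection : NormalTree.Projection em G T) where
  open Graph G
  open RootedSubtree T hiding (_≤T_)
  open Walks em _~_ ~-sym
  open NormalTree em G T
  open Projection projection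
  open Classical em
  open GraphNotions _~_

  -- Cones of tree vertices.

  -- By `π-mono` an edge to a vertex outside the tree stays in the cone, so `v` is in the tree. It
  -- lies below `π u`, as `t` does; hence the two are comparable, and `v` cannot lie above `t`.
  cone-exit : ∀ {t u v} → u ~ v → t ⊑ π u → ¬ t ⊑ π v → v ⊑ t × v ≢ t
  cone-exit {t} {u} {v} e t⊑ t⋢ with em {inT v}
  ... | no v∉ = ⊥-elim (t⋢ (⊑-trans t⊑ (π-mono e v∉)))
  ... | yes v∈ = below (v⊑πu (em {inT u})) ,
                 λ { refl → t⋢ (subst (t ⊑_) (sym (π-fixes v∈)) (⊑-refl v∈)) }
    where
    t⋢v : ¬ t ⊑ v
    t⋢v p = t⋢ (subst (t ⊑_) (sym (π-fixes v∈)) p)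
    v⊑πu : _ → v ⊑ π u
    v⊑πu (no u∉) = subst (_⊑ π u) (π-fixes v∈) (π-mono (~-sym e) u∉)
    v⊑πu (yes u∈) with edge-comp e u∈ v∈
    ... | inj₁ u⊑v = ⊥-elim (t⋢v (⊑-trans t⊑ (subst (_⊑ v) (sym (π-fixes u∈)) u⊑v)))
    ... | inj₂ v⊑u = subst (v ⊑_) (sym (π-fixes u∈)) v⊑u
    below : v ⊑ π u → v ⊑ t
    below v⊑ with ⊑-comparable v⊑ t⊑
    ... | inj₁ p = p
    ... | inj₂ p = ⊥-elim (t⋢v p)

  -- Cones are connected: walk to the projection inside its fibre, then descend the tree to `t`.
  coneWalk : ∀ {t v} → t ⊑ π v → Walk (λ x → t ⊑ π x) v t
  coneWalk {t} {v} t⊑ =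
    walk-map (λ e → subst (t ⊑_) (sym e) t⊑) (π-walk v) ◅◅
    walk-map (λ (p , q) → subst (t ⊑_) (sym (π-fixes (⊑-In q))) p) (treeWalk t⊑)

  -- Greedy selection.

  -- The outer ends `u` of edges leaving the cone are its neighbours. As `⊑` is reflexive, `s` may
  -- itself be one, in accordance with strips that include their lower end.
  Good : V → V → Set
  Good v s = ∀ w u → w ~ u → v ⊑ π w → ¬ v ⊑ π u → s ⊑ u

  -- Greedy selection along each branch: v is selected if all neighbours of its cone
  -- lie above the previously selected vertex. The second component counts the
  -- selected vertices passed on the way.
  search : ℕ → V → V × ℕ
  search zero    v = v , 0
  search (suc n) v with em {Good v (proj₁ (search n (parent v)))}
  ... | yes _ = v , suc (proj₂ (search n (parent v)))
  ... | no  _ = search n (parent v)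

  -- For a tree vertex the fuel `height v` is exactly the number of steps down to the root, where
  -- the search stops and returns the root.
  near : V → V
  near v = proj₁ (search (height v) v)

  depth : V → ℕ
  depth v = proj₂ (search (height v) v)

  search-step : ∀ n v → let s , d = search n (parent v) in
    (Good v s × search (suc n) v ≡ (v , suc d)) ⊎ (¬ Good v s × search (suc n) v ≡ (s , d))
  search-step n v with em {Good v (proj₁ (search n (parent v)))}
  ... | yes g = inj₁ (g , refl)
  ... | no ¬g = inj₂ (¬g , refl)

  near-step : ∀ {v} → inT v → 0 < height v →
    (Good v (near (parent v)) × near v ≡ v × depth v ≡ suc (depth (parent v))) ⊎
    (¬ Good v (near (parent v)) × near v ≡ near (parent v) × depth v ≡ depth (parent v))
  near-step {v} i h with search-step (height (parent v)) v
  ... | inj₁ (g , e) = inj₁ (g , cong proj₁ (trans unfold e) , cong proj₂ (trans unfold e))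
    where unfold = cong (λ n → search n v) (sym (proj₂ (step⁺ v i h)))
  ... | inj₂ (¬g , e) = inj₂ (¬g , cong proj₁ (trans unfold e) , cong proj₂ (trans unfold e))
    where unfold = cong (λ n → search n v) (sym (proj₂ (step⁺ v i h)))

  depth≤height : ∀ v → depth v ≤ height v
  depth≤height v = go (height v) v
    where
    go : ∀ n v → proj₂ (search n v) ≤ n
    go zero    v = z≤n
    go (suc n) v with search-step n v
    ... | inj₁ (_ , e) = subst (_≤ suc n) (sym (cong proj₂ e)) (s≤s (go n (parent v)))
    ... | inj₂ (_ , e) = subst (_≤ suc n) (sym (cong proj₂ e)) (m≤n⇒m≤1+n (go n (parent v)))

  near-root : near root ≡ root
  near-root = cong (λ n → proj₁ (search n root)) root-h

  depth-root : depth root ≡ 0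
  depth-root = cong (λ n → proj₂ (search n root)) root-h

  near-⊑ : ∀ v → inT v → near v ⊑ v
  near-⊑ = tree-induction _ (subst (_⊑ root) (sym near-root) (⊑-refl root∈)) go
    where
    go : ∀ v → inT v → 0 < height v → near (parent v) ⊑ parent v → near v ⊑ v
    go v i h ih with near-step i h
    ... | inj₁ (_ , e , _) = subst (_⊑ v) (sym e) (⊑-refl i)
    ... | inj₂ (_ , e , _) = subst (_⊑ v) (sym e) (⊑-trans ih (parent-⊑ i h))

  near-In : ∀ {v} → inT v → inT (near v)
  near-In i = ⊑-In (near-⊑ _ i)

  near-idem : ∀ v → inT v → near (near v) ≡ near v × depth (near v) ≡ depth v
  near-idem = tree-induction _ (cong near near-root , cong depth near-root) go
    where
    go : ∀ v → inT v → 0 < height v →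
      near (near (parent v)) ≡ near (parent v) × depth (near (parent v)) ≡ depth (parent v) →
      near (near v) ≡ near v × depth (near v) ≡ depth v
    go v i h (ih₁ , ih₂) with near-step i h
    ... | inj₁ (_ , e , _) = cong near e , cong depth e
    ... | inj₂ (_ , e , d) = trans (cong near e) (trans ih₁ (sym e)) ,
                         trans (cong depth e) (trans ih₂ (sym d))

  parent-⋣ : ∀ {v} → inT v → 0 < height v → ¬ v ⊑ parent v
  parent-⋣ {v} i h p =
    <⇒≱ (subst (height (parent v) <_) (proj₂ (step⁺ v i h)) ≤-refl) (⊑-height p)

  -- With `near-⊑` this makes `near v` the highest selected vertex below `v`; antisymmetry then
  -- serves to identify nodes.
  near-max : ∀ {s} → near s ≡ s → ∀ v → inT v → s ⊑ v → s ⊑ near v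
  near-max {s} e = tree-induction _ base go
    where
    self : ∀ {v} → s ≡ v → inT v → s ⊑ near v
    self refl i = subst (s ⊑_) (sym e) (⊑-refl i)
    base : s ⊑ root → s ⊑ near root
    base p = self (⊑-antisym p (root-⊑ (⊑-In p))) root∈
    go : ∀ v → inT v → 0 < height v → (s ⊑ parent v → s ⊑ near (parent v)) →
      s ⊑ v → s ⊑ near v
    go v i h ih p with em {s ≡ v}
    ... | yes s≡v = self s≡v i
    ... | no s≢v with near-step i h
    ...   | inj₁ (_ , e' , _) = subst (s ⊑_) (sym e') p
    ...   | inj₂ (_ , e' , _) = subst (s ⊑_) (sym e') (ih (proj₂ (⊑-parent p s≢v)))

  near-step-fixed : ∀ {v} → inT v → near v ≡ v → 0 < height v →
    Good v (near (parent v)) × depth v ≡ suc (depth (parent v))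
  near-step-fixed {v} i e h with near-step i h
  ... | inj₁ (g , _ , d) = g , d
  ... | inj₂ (_ , e' , _) = ⊥-elim (parent-⋣ i h
    (subst (_⊑ parent v) (trans (sym e') e) (near-⊑ _ (proj₁ (step⁺ v i h)))))

  -- The decomposition tree on the selected vertices.

  Selected : V → Set
  Selected v = inT v × near v ≡ v

  -- True makes selectedness proof-irrelevant, so nodes with equal vertices are equal.
  N : Set
  N = Σ V λ v → True (em {Selected v})

  node : N → V
  node = proj₁

  node-sel : ∀ t → Selected (node t)
  node-sel t = toWitness (proj₂ t)

  node-In : ∀ t → inT (node t)
  node-In t = proj₁ (node-sel t)

  mkN : ∀ {v} → Selected v → N
  mkN {v} s = v , fromWitness s

  node-injective : ∀ {s t} → node s ≡ node t → s ≡ t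
  node-injective {v , p} {.v , q} refl = cong (v ,_) (T-irrelevant p q)

  rootN : N
  rootN = mkN (root∈ , near-root)

  nearN : V → N
  nearN v with em {inT v}
  ... | yes i = mkN (near-In i , proj₁ (near-idem v i))
  -- Default value off the tree, where the parent of the root may lie.
  ... | no _  = rootN

  nearN-≡ : ∀ {v} → inT v → node (nearN v) ≡ near v
  nearN-≡ {v} i with em {inT v}
  ... | yes _ = refl
  ... | no ¬i = ⊥-elim (¬i i)

  nearN-⊑ : ∀ {v} → inT v → node (nearN v) ⊑ v
  nearN-⊑ {v} i = subst (_⊑ v) (sym (nearN-≡ i)) (near-⊑ v i)

  nearN-max : ∀ t {v} → node t ⊑ v → node t ⊑ node (nearN v)
  nearN-max t {v} p = subst (node t ⊑_) (sym (nearN-≡ (proj₁ p)))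
    (near-max (proj₂ (node-sel t)) v (proj₁ p) p)

  parentN : N → N
  parentN t = nearN (parent (node t))

  depthN : N → ℕ
  depthN t = depth (node t)

  depthN-0 : ∀ t → depthN t ≡ 0 → t ≡ rootN
  depthN-0 t e with em {height (node t) ≡ 0}
  ... | yes h = node-injective (h0 _ (node-In t) h)
  ... | no h≢0 = ⊥-elim (1+n≢0 (trans (sym (proj₂
    (near-step-fixed (node-In t) (proj₂ (node-sel t)) (n≢0⇒n>0 h≢0)))) e))

  depth⇒height : ∀ t → 0 < depthN t → 0 < height (node t)
  depth⇒height t d = n≢0⇒n>0 λ h → <⇒≢ d (sym (trans
    (cong (depth) (h0 _ (node-In t) h)) depth-root))

  stepN : ∀ t → ⊤ → 0 < depthN t → ⊤ × suc (depthN (parentN t)) ≡ depthN t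
  stepN t _ d = tt , trans
    (cong suc (trans (cong depth (nearN-≡ j)) (proj₂ (near-idem _ j))))
    (sym (proj₂ (near-step-fixed i f h)))
    where
    i = node-In t
    f = proj₂ (node-sel t)
    h = depth⇒height t d
    j = proj₁ (step⁺ (node t) i h)

  module NodeTree = Tree {N} (λ _ → ⊤) parentN depthN stepN

  parent-In : ∀ t → 0 < depthN t → inT (parent (node t))
  parent-In t d = proj₁ (step⁺ (node t) (node-In t) (depth⇒height t d))

  parentN-⊑ : ∀ t → 0 < depthN t → node (parentN t) ⊑ node t
  parentN-⊑ t d = ⊑-trans (nearN-⊑ (parent-In t d))
    (parent-⊑ (node-In t) (depth⇒height t d))

  parentN-≢ : ∀ t → 0 < depthN t → parentN t ≢ t
  parentN-≢ t d e = <⇒≢ (≤-reflexive (proj₂ (stepN t tt d))) (cong depthN e)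

  -- A vertex strictly below `node t` lies below its tree parent, where `near-max` applies; so no
  -- node sits strictly between `parentN t` and `t`.
  ⊏⇒⊑parentN : ∀ s t → node s ⊑ node t → s ≢ t →
    0 < depthN t × node s ⊑ node (parentN t)
  ⊏⇒⊑parentN s t s⊑t s≢t = d , nearN-max s (proj₂ (⊑-parent s⊑t ne))
    where
    ne : node s ≢ node t
    ne e = s≢t (node-injective e)
    d : 0 < depthN t
    d = n≢0⇒n>0 λ e → ne (⊑-antisym s⊑t
      (subst (λ x → node x ⊑ node s) (sym (depthN-0 t e)) (root-⊑ (node-In s))))

  ⊑N⇒⊑ : ∀ {s t} → s NodeTree.⊑ t → node s ⊑ node t
  ⊑N⇒⊑ {t = t} (_ , k , k≤ , refl) = go k k≤
    where
    go : ∀ k → k ≤ depthN t → node (iter parentN k t) ⊑ node t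
    go zero    _  = ⊑-refl (node-In t)
    go (suc k) k< = ⊑-trans
      (parentN-⊑ (iter parentN k t) (NodeTree.iter-pos k t tt k<)) (go k (<⇒≤ k<))

  -- Descending through `parentN` never skips `s`, so the node order is the restriction of the order
  -- of the normal tree. The bound `n` on the depth gives termination.
  ⊑⇒⊑N : ∀ {s t} → node s ⊑ node t → s NodeTree.⊑ t
  ⊑⇒⊑N {s} {t} p = go (depthN t) t ≤-refl p
    where
    go : ∀ n t → depthN t ≤ n → node s ⊑ node t → s NodeTree.⊑ t
    go n t le p with em {s ≡ t}
    ... | yes refl = NodeTree.⊑-refl tt
    go zero t le p | no s≢t = ⊥-elim (<⇒≱ (proj₁ (⊏⇒⊑parentN s t p s≢t)) le)
    go (suc n) t le p | no s≢t with ⊏⇒⊑parentN s t p s≢t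
    ... | d , q = NodeTree.⊑-trans
      (go n (parentN t) (s≤s⁻¹ (subst (_≤ suc n) (sym (proj₂ (stepN t tt d))) le)) q)
      (NodeTree.parent-⊑ tt d)

  -- Parts and separators.

  home : V → N
  home v = nearN (π v)

  -- An interval of the normal tree, hence finite and connected; it turns out to be
  -- the separator of the edge below t.
  Strip : N → V → Set
  Strip t v = 0 < depthN t × node (parentN t) ⊑ v × v ⊑ parent (node t)

  -- `home v` is the highest node whose cone contains `v`, so the first alternative is the cone of
  -- `t` minus all higher selected cones. The second adds the separator towards the parent.
  Part : N → V → Set
  Part t v = home v ≡ t ⊎ Strip t v

  home-⊑ : ∀ v → node (home v) ⊑ π v
  home-⊑ v = nearN-⊑ (π-In v)

  strip-π : ∀ {t v} → Strip t v → π v ≡ v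
  strip-π (_ , _ , q) = π-fixes (⊑-In q)

  strip-⋣ : ∀ {t v} → Strip t v → ¬ node t ⊑ π v
  strip-⋣ {t} {v} st@(d , _ , q) p = parent-⋣ (node-In t) (depth⇒height t d)
    (⊑-trans (subst (node t ⊑_) (strip-π {t} st) p) q)

  strip-home : ∀ {t v} → Strip t v → home v ≡ parentN t
  strip-home {t} {v} st@(d , p , q) = node-injective (⊑-antisym
    (nearN-max (home v) (⊑-trans (subst (node (home v) ⊑_) (strip-π {t} st) (home-⊑ v)) q))
    (nearN-max (parentN t) (subst (node (parentN t) ⊑_) (sym (strip-π {t} st)) p)))

  -- The greedy choice enters here: `cone-exit` bounds the outer end from above, and the test passed
  -- by `node t` bounds it from below by the parent node.
  cone-strip : ∀ t {u v} → u ~ v → node t ⊑ π u → ¬ node t ⊑ π v → Strip t v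
  cone-strip t {u} {v} e t⊑ t⋢ =
    let v⊑t , v≢t = cone-exit e t⊑ t⋢
        h , v⊑p   = ⊑-parent v⊑t v≢t
        g , d     = near-step-fixed (node-In t) (proj₂ (node-sel t)) h
        j         = proj₁ (step⁺ (node t) (node-In t) h)
    in subst (0 <_) (sym d) (s≤s z≤n) ,
       subst (_⊑ v) (sym (nearN-≡ j)) (g u v e t⊑ t⋢) , v⊑p

  edge-part : ∀ {u v} → u ~ v → Part (home u) v ⊎ node (home u) ⊑ π v
  edge-part {u} {v} e with em {node (home u) ⊑ π v}
  ... | yes p = inj₂ p
  ... | no ¬p = inj₁ (inj₂ (cone-strip (home u) e (home-⊑ u) ¬p))

  -- If the edge leaves the cone of one end's home, the other end is in the strip of that home.
  -- Otherwise each home lies below the other end's projection, and maximality makes the homes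
  -- equal.
  edge-cover : ∀ u v → u ~ v → Σ N λ t → Part t u × Part t v
  edge-cover u v e with edge-part e | edge-part (~-sym e)
  ... | inj₁ p | _      = home u , inj₁ refl , p
  ... | inj₂ _ | inj₁ q = home v , q , inj₁ refl
  ... | inj₂ p | inj₂ q = home u , inj₁ refl , inj₁ (node-injective
    (⊑-antisym (nearN-max (home v) q) (nearN-max (home u) p)))

  home-part : ∀ {t v} → Part t v → node (home v) ⊑ node t
  home-part {v = v} (inj₁ refl) = ⊑-refl (node-In (home v))
  home-part {t} (inj₂ st) =
    subst (λ x → node x ⊑ node t) (sym (strip-home {t} st)) (parentN-⊑ t (proj₁ st))

  -- The nodes whose part contains v form a star centred at home v, so coherence
  -- only needs the nodes between this centre and one of its leaves.
  part-between : ∀ {t s v} → Part t v → node (home v) ⊑ node s → node s ⊑ node t → Part s v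
  part-between (inj₁ refl) p q = inj₁ (node-injective (⊑-antisym p q))
  part-between {t} {s} {v} (inj₂ st) p q with em {s ≡ t}
  ... | yes refl = inj₂ st
  ... | no s≢t = inj₁ (node-injective (⊑-antisym p
    (subst (λ x → node s ⊑ node x) (sym (strip-home {t} st)) (proj₂ (⊏⇒⊑parentN s t q s≢t)))))

  D : TreeDecomp G
  D = record
    { N       = N
    ; root    = rootN
    ; parent  = parentN
    ; height  = depthN
    ; root-h  = depth-root
    ; h0      = depthN-0
    ; step    = λ t n e → suc-injective
        (trans (proj₂ (stepN t tt (subst (0 <_) (sym e) (s≤s z≤n)))) e)
    ; Part    = Part
    ; cover-v = λ v → home v , inj₁ refl
    ; cover-e = edge-cover
    ; coh     = λ where
        t₁ t₃ t₂ v (below , above) p₁ p₃ →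
          -- The centre `home v` lies below both `t₁` and `t₃`, hence below `t₂`, which is thus
          -- between the centre and one of them.
          let h⊑t₂ = ⊑N⇒⊑ (tt , above (home v) (proj₂ (⊑⇒⊑N (home-part p₁)))
                                                (proj₂ (⊑⇒⊑N (home-part p₃))))
          in [ (λ q → part-between p₁ h⊑t₂ (⊑N⇒⊑ (tt , q)))
             , (λ q → part-between p₃ h⊑t₂ (⊑N⇒⊑ (tt , q))) ]′ below
    }

  open TreeDecomp D using (Sep; _~N_; _≤T_)

  sep⇒strip : ∀ {t v} → 0 < depthN t → Sep t v → Strip t v
  sep⇒strip d (inj₂ st , _) = st
  sep⇒strip {t} d (inj₁ refl , q) =
    ⊥-elim (parentN-≢ t d (node-injective (⊑-antisym (parentN-⊑ t d) (home-part q))))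

  strip⇒sep : ∀ {t v} → Strip t v → Sep t v
  strip⇒sep {t} st = inj₂ st , inj₁ (strip-home {t} st)

  -- The strip of `t` starts at `parentN t`, which is above `s`, while the strip of `s` ends
  -- strictly below `s`.
  seps-up-disjoint : SepsUpDisjoint G D
  seps-up-disjoint s t ds dt s≢t s≤t v ss st =
    let _ , p , q  = sep⇒strip {s} ds ss
        _ , p' , _ = sep⇒strip {t} dt st
        s⊑pt       = proj₂ (⊏⇒⊑parentN s t (⊑N⇒⊑ (tt , s≤t)) s≢t)
    in parent-⋣ (node-In s) (depth⇒height s ds) (⊑-trans s⊑pt (⊑-trans p' q))

  seps-finite : SepsFinite G D
  seps-finite t d = ancestors (parent (node t)) ,
    λ v sep → ⊑⇒∈ancestors (proj₂ (proj₂ (sep⇒strip {t} d sep)))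

  seps-connected : SepsConnected G D
  seps-connected t d =
    (parent (node t) , strip⇒sep {t} (d , nearN-⊑ j , ⊑-refl j)) ,
    λ u v su sv → walk⇒joined su (connect (sep⇒strip {t} d su) (sep⇒strip {t} d sv))
    where
    j = parent-In t d
    downWalk : ∀ {u v} → Strip t u → Strip t v → u ⊑ v → Walk (Sep t) v u
    downWalk (_ , p , _) (_ , _ , q) u⊑v =
      walk-map (λ (l , r) → strip⇒sep {t} (d , ⊑-trans p l , ⊑-trans r q)) (treeWalk u⊑v)
    connect : ∀ {u v} → Strip t u → Strip t v → Walk (Sep t) u v
    connect su sv with ⊑-comparable (proj₂ (proj₂ su)) (proj₂ (proj₂ sv))
    ... | inj₁ u⊑v = walk-rev (downWalk su sv u⊑v)
    ... | inj₂ v⊑u = downWalk sv su v⊑u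

  covers : CoversCofinally G D inT
  covers t = t , proj₂ (NodeTree.⊑-refl tt) , node t , inj₁ (node-injective (trans
    (nearN-≡ (π-In (node t)))
    (trans (cong near (π-fixes (node-In t))) (proj₂ (node-sel t))))) , node-In t

  -- Orientation of tree edges by rays.

  UpSide⇐ : ∀ {t v} → 0 < depthN t → node t ⊑ π v → UpSide G D t v
  UpSide⇐ {t} {v} d p = (home v , proj₂ (⊑⇒⊑N (nearN-max t p)) , inj₁ refl) ,
    λ sep → strip-⋣ {t} (sep⇒strip {t} d sep) p

  -- Together with `UpSide⇐` this identifies the upper side with the cone. A strip vertex of a
  -- strictly higher node `s` lies above `parentN s`, hence above `t`; the strip of `t` itself is
  -- removed as the separator.
  UpSide⇒ : ∀ {t v} → UpSide G D t v → node t ⊑ π v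
  UpSide⇒ {v = v} ((s , t≤s , inj₁ refl) , _) = ⊑-trans (⊑N⇒⊑ (tt , t≤s)) (home-⊑ v)
  UpSide⇒ {t} ((s , t≤s , inj₂ st) , ¬sep) with em {t ≡ s}
  ... | yes refl = ⊥-elim (¬sep (strip⇒sep {t} st))
  ... | no t≢s = subst (node t ⊑_) (sym (strip-π {s} st))
    (⊑-trans (proj₂ (⊏⇒⊑parentN t s (⊑N⇒⊑ (tt , t≤s)) t≢s)) (proj₁ (proj₂ st)))

  DownSide⇐ : ∀ {t v} → 0 < depthN t → ¬ node t ⊑ π v × v ∉ ancestors (node t) →
    DownSide G D t v
  DownSide⇐ {t} {v} d (¬p , v∉) =
    (home v , (λ t≤h → ¬p (⊑-trans (⊑N⇒⊑ (tt , t≤h)) (home-⊑ v))) , inj₁ refl) ,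
    λ sep → v∉ (⊑⇒∈ancestors (⊑-trans (proj₂ (proj₂ (sep⇒strip {t} d sep)))
      (parent-⊑ (node-In t) (depth⇒height t d))))

  DownSide⇒ : ∀ {t v} → DownSide G D t v → ¬ node t ⊑ π v
  DownSide⇒ {t} ((s , t≰s , part) , _) p =
    t≰s (proj₂ (⊑⇒⊑N (⊑-trans (nearN-max t p) (home-part part))))

  record Up (R : Ray) (t : V) : Set where
    constructor eventually
    field tail : HasTail R λ v → t ⊑ π v

  -- By `cone-exit` all neighbours of the cone are strict ancestors of `t`. So for a child of `t`
  -- the list of ancestors of `t` already suffices as `X`.
  cone-invariant : ∀ {t X} → (∀ {v} → v ⊑ t → v ≢ t → v ∈ X) →
    ∀ {a b} → a ∉ X → b ∉ X → a ~ b → t ⊑ π a → t ⊑ π b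
  cone-invariant sub _ b∉ e p = byContradiction λ ¬p →
    let v⊑t , v≢t = cone-exit e p ¬p in b∉ (sub v⊑t v≢t)

  module Cone (t : V) = Side (λ v → t ⊑ π v) (ancestors t)
    (cone-invariant λ p _ → ⊑⇒∈ancestors p)

  up-transfer : ∀ {R R' t} → RayEquiv R R' → Up R t → Up R' t
  up-transfer {R} {R'} {t} eq (eventually up) = eventually (Cone.transfer t {R} {R'} eq up)

  up-comparable : ∀ {R s t} → Up R s → Up R t → s ⊑ t ⊎ t ⊑ s
  up-comparable (eventually (n , p)) (eventually (m , q)) =
    ⊑-comparable (p (n ⊔ m) (m≤m⊔n n m)) (q (n ⊔ m) (m≤n⊔m n m))

  up-lower : ∀ {R s t} → s ⊑ t → Up R t → Up R s
  up-lower s⊑t (eventually (n , p)) = eventually (n , λ m n≤m → ⊑-trans s⊑t (p m n≤m))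

  up-root : ∀ {R} → Up R root
  up-root = eventually (0 , λ _ _ → root-⊑ (π-In _))

  pointsUp⇐ : ∀ {R} t → 0 < depthN t → Up R (node t) → PointsUp G D R t
  pointsUp⇐ t d (eventually (n , p)) = n , λ m n≤m → UpSide⇐ {t} d (p m n≤m)

  pointsUp⇒ : ∀ {R} t → PointsUp G D R t → Up R (node t)
  pointsUp⇒ t (n , p) = eventually (n , λ m n≤m → UpSide⇒ {t} (p m n≤m))

  up-or-pointsDown : ∀ R t → 0 < depthN t → Up R (node t) ⊎ PointsDown G D R t
  up-or-pointsDown R t d with Cone.dichotomy (node t) R
  ... | inj₁ up         = inj₁ (eventually up)
  ... | inj₂ (n , down) = inj₂ (n , λ m n≤m → DownSide⇐ {t} d (down m n≤m))

  pointsDown⇒ : ∀ {R} t → PointsDown G D R t → ¬ Up R (node t)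
  pointsDown⇒ t (n , p) (eventually (m , q)) =
    DownSide⇒ {t} (p (n ⊔ m) (m≤m⊔n n m)) (q (n ⊔ m) (m≤n⊔m n m))

  -- Rays with tails in arbitrarily high selected cones.

  Unbounded : Ray → Set
  Unbounded R = ∀ n → Σ N λ t → n ≤ height (node t) × Up R (node t)

  HasUpSuccessor : Ray → N → Set
  HasUpSuccessor R t = Σ N λ s → node t ⊑ node s × t ≢ s × Up R (node s)

  unbounded : ∀ {R} → (∀ t → Up R (node t) → HasUpSuccessor R t) → Unbounded R
  unbounded next zero    = rootN , z≤n , up-root
  unbounded next (suc n) with unbounded next n
  ... | t , h , up with next t up
  ...   | s , t⊑s , t≢s , up' =
    s , ≤-trans (s≤s h) (⊑-height-< t⊑s λ e → t≢s (node-injective e)) , up'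

  -- A vertex higher than `π x` cannot lie below it, so all sufficiently high cones miss a given
  -- finite set.
  escape : ∀ X → Σ ℕ λ n → ∀ t → n ≤ height t → ∀ x → x ∈ X → ¬ t ⊑ π x
  escape []      = 0 , λ _ _ _ ()
  escape (x ∷ X) with escape X
  ... | n , esc = n ⊔ suc (height (π x)) , λ where
    t h _ (here refl) p → <⇒≱ (m⊔n≤o⇒n≤o n _ h) (⊑-height p)
    t h y (there y∈)  p → esc t (m⊔n≤o⇒m≤o n _ h) y y∈ p

  -- A cone too high to meet `X` is connected and holds tails of both rays, so `X` does not separate
  -- them.
  equiv-of-cones : ∀ {R R'} →
    (∀ n → Σ V λ t → n ≤ height t × Up R t × Up R' t) → RayEquiv R R'
  equiv-of-cones cones X with escape X
  ... | n , esc with cones n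
  ... | t , h , eventually (k , up) , eventually (k' , up') =
    k , k' , (λ m le → out (up m le)) , (λ m le → out (up' m le)) ,
    walk⇒joined (out (up k ≤-refl)) (walk-map out
      (coneWalk (up k ≤-refl) ◅◅ walk-rev (coneWalk (up' k' ≤-refl))))
    where
    out : ∀ {x} → t ⊑ π x → x ∉ X
    out p x∈ = esc t h _ x∈ p

  -- Branches of the normal tree and vertices dominating them.

  module Branch (vertex : ℕ → V) (vertex-height : ∀ k → height (vertex k) ≡ k)
    (vertex-comparable : ∀ j k → vertex j ⊑ vertex k ⊎ vertex k ⊑ vertex j) where

    vertex-mono : ∀ {j k} → j ≤ k → vertex j ⊑ vertex k
    vertex-mono {j} {k} j≤k = ⊑-of-comparable (vertex-comparable j k)
      (subst₂ _≤_ (sym (vertex-height j)) (sym (vertex-height k)) j≤k)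

    vertex-In : ∀ k → inT (vertex k)
    vertex-In k = ⊑-In (vertex-mono {k} ≤-refl)

    vertex-injective : ∀ j k → vertex j ≡ vertex k → j ≡ k
    vertex-injective j k e =
      trans (sym (vertex-height j)) (trans (cong height e) (vertex-height k))

    vertex-step : ∀ k → 0 < height (vertex (suc k)) × vertex k ≡ parent (vertex (suc k))
    vertex-step k with ⊑-parent (vertex-mono (n≤1+n k)) (λ e → 1+n≢n (sym (vertex-injective _ _ e)))
    ... | h , p = h , ⊑-height-≡ p (trans (vertex-height k) (suc-injective (sym
      (trans (proj₂ (step⁺ _ (vertex-In (suc k)) h)) (vertex-height (suc k))))))

    ray : Ray
    ray = mkRay vertex vertex-injective λ k → let h , e = vertex-step k in
      subst (_~ vertex (suc k)) (sym e) (parent-~ _ (vertex-In (suc k)) h)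

    up-vertex : ∀ k → Up ray (vertex k)
    up-vertex k = eventually (k , λ m k≤m →
      subst (vertex k ⊑_) (sym (π-fixes (vertex-In m))) (vertex-mono k≤m))

    equiv-ray : ∀ {R} → (∀ k → Up R (vertex k)) → RayEquiv ray R
    equiv-ray up = equiv-of-cones λ n →
      vertex n , ≤-reflexive (sym (vertex-height n)) , up-vertex n , up n

    -- The branch is a comb with trivial paths, all its vertices being teeth.
    in-closure : ∀ {R} → (∀ k → Up R (vertex k)) → InClosure inT R
    in-closure up = record
      { spine    = ray
      ; foot     = λ i → i
      ; tl       = λ _ → []
      ; linkedP  = λ _ → [-]
      ; uniqueP  = λ _ → [] ∷ []
      ; offSpine = λ _ → []
      ; disjoint = λ { i j i≢j v (here refl) (here e) → i≢j (vertex-injective i j e) }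
      ; teeth    = vertex-In
      } , equiv-ray up

    -- Neighbours of `u` in arbitrarily high cones yield a fan from `u` to the branch: each blade
    -- stays in one cone apart from `u`, and the next cone is chosen too high to meet it.
    module Fan (u : V) (u∈ : inT u)
      (attached : ∀ n → Σ V λ w → u ~ w × vertex n ⊑ π w) where

      -- The offset lifts every level above the height of `u`, so `u` lies in none of these cones.
      level : ℕ → V
      level n = vertex (suc (height u) + n)

      u∉level : ∀ n → ¬ level n ⊑ π u
      u∉level n p = <⇒≱
        (subst (height u <_) (sym (vertex-height _)) (s≤s (m≤m+n (height u) n)))
        (⊑-height (subst (level n ⊑_) (π-fixes u∈) p))

      record Blade (n : ℕ) : Set where
        field
          mid    : List V
          hit    : ℕ
        path : List V
        path = mid ++ vertex hit ∷ []
        field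
          linked : Linked _~_ (u ∷ path)
          unique : Unique (u ∷ path)
          off    : All (λ x → ∀ m → x ≢ vertex m) mid
          inCone : All (λ x → level n ⊑ π x) path
      open Blade

      OnRay : V → Set
      OnRay x = Σ ℕ λ m → x ≡ vertex m

      blade : ∀ n → Blade n
      blade n with attached (suc (height u) + n)
      ... | w , e , w⊑ with em {OnRay w}
      ...   | yes (m , refl) = record
        { mid = [] ; hit = m ; linked = e ∷ [-]
        ; unique = ((λ { refl → u∉level n w⊑ }) ∷ []) ∷ [] ∷ []
        ; off = [] ; inCone = w⊑ ∷ [] }
      -- The walk to the base of the cone ends on the branch; stopping at its first branch vertex
      -- keeps the interior off the ray.
      ...   | no w∉ with firstHit {Q = OnRay} (coneWalk w⊑) w∉ (_ , refl)
      ...     | c , _ , walk , _ , e' , d⊑ , (m , refl)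
          with walk⇒linkingPath e (w⊑ , w∉) walk e' (λ (p , _) → u∉level n p)
                 (λ (_ , ∉ray) → ∉ray (m , refl)) (λ { refl → u∉level n d⊑ })
      ...       | ms , al , l , un = record
        { mid = ms ; hit = m ; linked = l ; unique = un
        ; off = All.map (λ (_ , ∉ray) k e → ∉ray (k , e)) al
        ; inCone = AllP.++⁺ (All.map proj₁ al) (d⊑ ∷ []) }

      start : ℕ → ℕ
      start zero    = 0
      -- From this index on, the level cones contain no vertex of the current blade.
      start (suc i) = start i ⊔ proj₁ (escape (path (blade (start i))))

      start-mono : ∀ i j → i ≤ j → start i ≤ start j
      start-mono i = ≤-step-invariant (λ j → start i ≤ start j) i ≤-refl
        λ k _ p → ≤-trans p (m≤m⊔n (start k) _)

      later-disjoint : ∀ i j → i < j → ∀ x →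
        x ∈ path (blade (start i)) → x ∉ path (blade (start j))
      later-disjoint i j i<j x x∈i x∈j =
        proj₂ (escape (path (blade (start i)))) (level (start j))
          (subst (proj₁ (escape (path (blade (start i)))) ≤_) (sym (vertex-height _))
            (≤-trans (m≤n⊔m (start i) _)
              (≤-trans (start-mono (suc i) j i<j) (m≤n+m (start j) (suc (height u))))))
          x x∈i (All.lookup (inCone (blade (start j))) x∈j)

      dominates : Dominates u ray
      dominates =
        (λ i → mid (b i)) , (λ i → hit (b i)) ,
        (λ i → linked (b i)) , (λ i → unique (b i)) ,
        (λ i e → u∉level (start i) (subst (λ x → level (start i) ⊑ π x) e
          (All.lookup (inCone (b i)) (∈-++⁺ʳ (mid (b i)) (here refl))))) ,
        (λ i → off (b i)) , disj
        where
        b = λ i → blade (start i)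
        disj : ∀ i j → i ≢ j → ∀ x → x ∈ path (b i) → x ∉ path (b j)
        disj i j i≢j x x∈i x∈j with ≤-total i j
        ... | inj₁ i≤j = later-disjoint i j (≤∧≢⇒< i≤j i≢j) x x∈i x∈j
        ... | inj₂ j≤i = later-disjoint j i (≤∧≢⇒< j≤i λ e → i≢j (sym e)) x x∈j x∈i

  -- Unbounded rays and undominated ends in the closure.

  Branching : Ray → Set
  Branching R = ∀ k → Σ V λ v → height v ≡ k × Up R v

  module BranchOf {R : Ray} (β : Branching R) where
    open Branch (λ k → proj₁ (β k)) (λ k → proj₁ (proj₂ (β k)))
      (λ j k → up-comparable (proj₂ (proj₂ (β j))) (proj₂ (proj₂ (β k)))) public

    up : ∀ k → Up R (proj₁ (β k))
    up k = proj₂ (proj₂ (β k))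

  unbounded⇒branching : ∀ {R} → Unbounded R → Branching R
  unbounded⇒branching unb k =
    let t , h , up  = unb k
        v , v⊑t , e = ancestorAt (node-In t) h
    in v , e , up-lower v⊑t up

  unbounded⇒closure : ∀ {R} → Unbounded R → InClosure inT R
  unbounded⇒closure {R} unb = in-closure up
    where
    open BranchOf {R} (unbounded⇒branching {R} unb)

  -- The cone of `s` is chosen to miss `v`, and `t` strictly above `s`, so the strip of `t` lies
  -- above `s` and misses `v`. Every path from `v` into the cone of `t` crosses this finite strip,
  -- which only finitely many paths of a fan can do.
  unbounded⇒undominated : ∀ {R} → Unbounded R → Undominated R
  unbounded⇒undominated {R} unb R' eq v (mid , hit , lk , _ , _ , _ , disj)
    with escape (v ∷ [])
  ... | n , esc with unb n
  ... | s , hs , ups with unb (suc (height (node s)))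
  ... | t , ht , upt with up-transfer {R} {R'} eq upt
  -- Avoiding the initial segment of `R'` puts the hit in the cone of `t`; avoiding the ancestors of
  -- `t` keeps the path off the strip.
  ... | eventually (k , upt') with disjoint-avoids _ disj (segment R' k ++ ancestors (node t))
  ... | i , avoid = blocked
    where
    path : List V
    path = mid i ++ at R' (hit i) ∷ []

    s⊑t : node s ⊑ node t
    s⊑t = ⊑-of-comparable (up-comparable ups upt) (≤-trans (n≤1+n _) ht)

    s⊑parentN : node s ⊑ node (parentN t)
    s⊑parentN = proj₂ (⊏⇒⊑parentN s t s⊑t λ { refl → 1+n≰n ht })

    t⊑hit : node t ⊑ π (at R' (hit i))
    t⊑hit = upt' (hit i) (∉segment⇒≥ R' λ h∈ →
      avoid i ≤-refl _ (∈-++⁺ˡ h∈) (∈-++⁺ʳ (mid i) (here refl)))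

    ¬v-above-s : ¬ node s ⊑ π v
    ¬v-above-s = esc (node s) hs v (here refl)

    strip-off-path : ∀ {x} → Strip t x → x ∉ v ∷ path
    strip-off-path st@(d , p , q) (here refl) = ¬v-above-s
      (⊑-trans s⊑parentN (subst (node (parentN t) ⊑_) (sym (strip-π {t} st)) p))
    strip-off-path (d , p , q) (there x∈) = avoid i ≤-refl _
      (∈-++⁺ʳ (segment R' k) (⊑⇒∈ancestors
        (⊑-trans q (parent-⊑ (node-In t) (depth⇒height t d))))) x∈

    blocked : _
    blocked with firstHit {P = _∈ v ∷ path} {Q = λ x → node t ⊑ π x}
        (list⇒walk v path (lk i) (All.tabulate λ x∈ → x∈))
        (λ t⊑v → ¬v-above-s (⊑-trans s⊑t t⊑v))
        (subst (λ x → node t ⊑ π x) (sym (lastOr-snoc v (mid i) _)) t⊑hit)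
    ... | c , d , _ , (c∈ , t⋢c) , e , _ , t⊑d =
      strip-off-path (cone-strip t (~-sym e) t⊑d t⋢c) c∈

  -- A comb path far out avoids the ancestors of `t`, so its tooth lies strictly above `t`. The cone
  -- of the next vertex `t'` towards the tooth can only be left through ancestors of `t`, so it
  -- contains the foot of this path and the spine from there on.
  closure-ascends : ∀ {R} → InClosure inT R → ∀ {t} → Up R t →
    Σ V λ t' → height t' ≡ suc (height t) × Up R t'
  closure-ascends {R} (C , eq) {t} upR with up-transfer {R} {Comb.spine C} (equiv-sym {Comb.spine C} {R} eq) upR
  ... | eventually (k , up) with ray-avoids (Comb.spine C) (ancestors t)
  -- Beyond `k` the spine is in the cone of `t`, beyond `n` it avoids the ancestors of `t`; the
  -- added segment forces the foot past both.
  ... | n , av with disjoint-avoids _ (Comb.disjoint C)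
                      (ancestors t ++ segment (Comb.spine C) (n ⊔ k))
  ... | i , avoid = t' , ht' , up-transfer {spine} {R} eq (eventually (foot i ,
        ray-invariant t'-invariant spine (foot i)
          (λ m le → av m (≤-trans (m⊔n≤o⇒m≤o n k foot≥) le)) t'⊑foot))
    where
    open Comb C
    foot≥ : n ⊔ k ≤ foot i
    foot≥ = ∉segment⇒≥ spine λ f∈ →
      avoid i ≤-refl _ (∈-++⁺ʳ (ancestors t) f∈) (here refl)

    tooth : V
    tooth = lastOr (at spine (foot i)) (tl i)

    tooth-π : π tooth ≡ tooth
    tooth-π = π-fixes (teeth i)

    off-t : All (_∉ ancestors t) (at spine (foot i) ∷ tl i)
    off-t = All.tabulate λ x∈ x∈t → avoid i ≤-refl _ (∈-++⁺ˡ x∈t) x∈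

    toTooth : Walk (_∉ ancestors t) (at spine (foot i)) tooth
    toTooth = list⇒walk _ (tl i) (linkedP i) off-t

    t⊑tooth : t ⊑ tooth
    t⊑tooth = subst (t ⊑_) tooth-π (walk-invariant
      (cone-invariant λ p _ → ⊑⇒∈ancestors p) toTooth (up (foot i) (m⊔n≤o⇒n≤o n k foot≥)))

    tooth≢t : t ≢ tooth
    tooth≢t e = walk-end∉ toTooth (subst (_∈ ancestors t) e
      (⊑⇒∈ancestors (⊑-refl (⊑-In t⊑tooth))))
      where
      walk-end∉ : ∀ {b} → Walk (_∉ ancestors t) (at spine (foot i)) b → b ∉ ancestors t
      walk-end∉ w = walk-invariant {I = _∉ ancestors t} (λ _ q _ _ → q) w (All.head off-t)

    next = ancestorAt (teeth i) (⊑-height-< t⊑tooth tooth≢t)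
    t'  = proj₁ next
    ht' = proj₂ (proj₂ next)

    t⊑t' : t ⊑ t'
    t⊑t' = ⊑-of-comparable (⊑-comparable t⊑tooth (proj₁ (proj₂ next)))
      (≤-trans (n≤1+n _) (≤-reflexive (sym ht')))

    t'-invariant : ∀ {a b} → a ∉ ancestors t → b ∉ ancestors t → a ~ b →
      t' ⊑ π a → t' ⊑ π b
    t'-invariant = cone-invariant λ {v} v⊑t' v≢t' → ⊑⇒∈ancestors
      (⊑-of-comparable (⊑-comparable v⊑t' t⊑t')
        (s≤s⁻¹ (subst (height v <_) ht' (⊑-height-< v⊑t' v≢t'))))

    t'⊑foot : t' ⊑ π (at spine (foot i))
    t'⊑foot = walk-invariant t'-invariant (walk-rev toTooth)
      (subst (t' ⊑_) (sym tooth-π) (proj₁ (proj₂ next)))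

  closure⇒branching : ∀ {R} → InClosure inT R → Branching R
  closure⇒branching cl zero = root , root-h , up-root
  closure⇒branching cl (suc k) with closure⇒branching cl k
  ... | v , refl , up = closure-ascends cl up

  module LastSelected {R : Ray} (β : Branching R) (t : N) (upt : Up R (node t))
    (last : ¬ HasUpSuccessor R t) where
    open BranchOf {R} β

    vertex : ℕ → V
    vertex k = proj₁ (β k)

    vertex-height : ∀ k → height (vertex k) ≡ k
    vertex-height k = proj₁ (proj₂ (β k))

    -- The shift starts the sequence just above `node t`, at the first vertex tested against it.
    x : ℕ → V
    x k = vertex (suc (height (node t) + k))

    Attached : V → ℕ → Set
    Attached u k = Σ V λ w → u ~ w × x k ⊑ π w × u ⊑ node t

    -- Any other value would be a node above `t` whose cone still contains a tail of `R`,
    -- contradicting `last`.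
    near-vertex : ∀ j → height (node t) ≤ j → near (vertex j) ≡ node t
    near-vertex j le = byContradiction λ ne → last
      (nearN (vertex j) , nearN-max t t⊑ ,
       (λ e → ne (trans (sym (nearN-≡ (vertex-In j))) (cong node (sym e)))) ,
       up-lower (nearN-⊑ (vertex-In j)) (up j))
      where
      t⊑ : node t ⊑ vertex j
      t⊑ = ⊑-of-comparable (up-comparable upt (up j))
        (≤-trans le (≤-reflexive (sym (vertex-height j))))

    not-good : ∀ k → ¬ Good (x k) (node t)
    not-good k good with vertex-step (height (node t) + k)
    ... | h , e with near-step (vertex-In (suc (height (node t) + k))) h
    ...   | inj₁ (_ , fixed , _) = <⇒≢ (s≤s (m≤m+n (height (node t)) k)) (trans
      (cong height (trans (sym (near-vertex (suc (height (node t) + k)) (m≤n⇒m≤1+n (m≤m+n _ k)))) fixed))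
      (vertex-height (suc (height (node t) + k))))
    ...   | inj₂ (¬good , _) = ¬good (subst (Good (x k))
      (trans (sym (near-vertex (height (node t) + k) (m≤m+n (height (node t)) k))) (cong near e)) good)

    -- A failed test yields a neighbour of the cone that is not above `t`. It lies below `x k`, as
    -- `t` does, so it is one of the finitely many ancestors of `t`, a set independent of `k`.
    attached : ∀ k → Σ V λ u → u ∈ ancestors (node t) × Attached u k
    attached k = byContradiction λ none → not-good k λ w u e x⊑w x⋢u →
      byContradiction λ t⋢u → none (u , witness w u e x⊑w x⋢u t⋢u)
      where
      witness : ∀ w u → w ~ u → x k ⊑ π w → ¬ x k ⊑ π u → ¬ node t ⊑ u →
        u ∈ ancestors (node t) × Attached u k
      witness w u e x⊑w x⋢u t⋢u with cone-exit e x⊑w x⋢u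
      ... | u⊑x , _ with ⊑-comparable u⊑x (subst (_⊑ x k)
                           (near-vertex (suc (height (node t) + k)) (m≤n⇒m≤1+n (m≤m+n (height (node t)) k)))
                           (near-⊑ _ (vertex-In (suc (height (node t) + k)))))
      ...   | inj₁ u⊑t = ⊑⇒∈ancestors u⊑t , w , ~-sym e , x⊑w , u⊑t
      ...   | inj₂ t⊑u = ⊥-elim (t⋢u t⊑u)

    dominating : Σ V λ v → Dominates v ray
    dominating = let u , _ , inf = infinite-pigeonhole Attached (ancestors (node t)) attached
                     _ , _ , _ , _ , _ , u⊑t = inf 0
      in u , Fan.dominates u (⊑-In u⊑t) λ n →
           let k , n≤k , w , e , x⊑w , _ = inf n
           in w , e , ⊑-trans (vertex-mono (m≤n⇒m≤1+n (≤-trans n≤k (m≤n+m k _)))) x⊑w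

  undominated⇒unbounded : ∀ {R} → Undominated R → InClosure inT R → Unbounded R
  undominated⇒unbounded {R} und cl = unbounded λ t upt → byContradiction λ last →
    let v , dom = LastSelected.dominating β t upt last
    in und ray (equiv-sym {ray} {R} (equiv-ray up)) v dom
    where
    β = closure⇒branching cl
    open BranchOf {R} β

  -- Displaying the undominated ends in the closure.

  Ψ : Ray → Set
  Ψ R = Undominated R × InClosure inT R

  Ψ⇒unbounded : ∀ {R} → Ψ R → Unbounded R
  Ψ⇒unbounded {R} (und , cl) = undominated⇒unbounded {R} und cl

  unbounded⇒Ψ : ∀ {R} → Unbounded R → Ψ R
  unbounded⇒Ψ {R} unb = unbounded⇒undominated {R} unb , unbounded⇒closure {R} unb

  -- If the edge below a node `s` not below `t` pointed up, `s` would be comparable with `t` and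
  -- hence a later node whose cone contains a tail of `R`.
  lives-at-last : ∀ R t → Up R (node t) → ¬ HasUpSuccessor R t → LivesAt G D R t
  lives-at-last R t upt last s d =
    (λ s≤t → pointsUp⇐ s d (up-lower (⊑N⇒⊑ (tt , s≤t)) upt)) ,
    λ s≰t → case-down s≰t (up-or-pointsDown R s d)
    where
    case-down : ¬ s ≤T t → Up R (node s) ⊎ PointsDown G D R s → PointsDown G D R s
    case-down s≰t (inj₂ down) = down
    case-down s≰t (inj₁ ups) with up-comparable ups upt
    ... | inj₁ s⊑t = ⊥-elim (s≰t (proj₂ (⊑⇒⊑N s⊑t)))
    ... | inj₂ t⊑s = ⊥-elim (last
      (s , t⊑s , (λ { refl → s≰t (proj₂ (⊑⇒⊑N t⊑s)) }) , ups))

  lives-at-node : ∀ R → ¬ Ψ R → Σ N λ u → LivesAt G D R u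
  lives-at-node R ¬Ψ = byContradiction λ none → ¬Ψ (unbounded⇒Ψ {R} (unbounded λ t up →
    byContradiction λ last → none (t , lives-at-last R t up last)))

  ~N-sym : ∀ {s t} → s ~N t → t ~N s
  ~N-sym (inj₁ p) = inj₂ p
  ~N-sym (inj₂ p) = inj₁ p

  module NodeWalks = Walks em _~N_ ~N-sym
  module NodeGraph = GraphNotions _~N_

  -- The only edge leaving the up-closure of `t` starts at `t`, so this single node separates.
  node-side : ∀ t {a b} → a ∉ t ∷ [] → b ∉ t ∷ [] → a ~N b → t ≤T a → t ≤T b
  node-side t {a} {b} a∉ b∉ (inj₁ (d , refl)) t≤a =
    proj₂ (NodeTree.⊑-trans (tt , t≤a) (NodeTree.parent-⊑ {b} tt d))
  node-side t {a} {b} a∉ b∉ (inj₂ (d , refl)) t≤a =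
    proj₂ (proj₂ (NodeTree.⊑-parent {t} {a} (tt , t≤a) λ { refl → a∉ (here refl) }))

  module NodeSide (t : N) = NodeWalks.Side (t ≤T_) (t ∷ []) (node-side t)

  -- If the cone of `t` contains a tail of `R`, then `t` is comparable with late nodes of `η` at
  -- least as deep as `t`, hence below them; so `η` has no tail beside `t`.
  corresponds : ∀ R (η : NodeGraph.Ray) →
    (∀ n → Σ ℕ λ m → n ≤ m × n ≤ depthN (NodeGraph.at η m) × Up R (node (NodeGraph.at η m))) →
    CorrespondsTo G D R η
  corresponds R η cofinal t d = above , beside
    where
    above : NodeGraph.HasTail η (t ≤T_) → PointsUp G D R t
    above (n , t≤) with cofinal n
    ... | m , n≤m , _ , up = pointsUp⇐ t d (up-lower (⊑N⇒⊑ (tt , t≤ m n≤m)) up)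
    beside : NodeGraph.HasTail η (λ s → ¬ t ≤T s) → PointsDown G D R t
    beside (n , t≰) with up-or-pointsDown R t d
    ... | inj₂ down = down
    ... | inj₁ upt with cofinal (n ⊔ depthN t)
    ...   | m , le , deep , up = ⊥-elim (t≰ m (m⊔n≤o⇒m≤o n _ le) (proj₂ (t⊑ (up-comparable upt up))))
      where
      s = NodeGraph.at η m
      t⊑ : node t ⊑ node s ⊎ node s ⊑ node t → t NodeTree.⊑ s
      t⊑ (inj₁ p) = ⊑⇒⊑N p
      t⊑ (inj₂ p) = NodeTree.⊑-of-comparable (inj₂ (⊑⇒⊑N p)) (m⊔n≤o⇒n≤o n _ deep)

  UpChild : Ray → N → Set
  UpChild R t = Σ N λ s → Up R (node s) × 0 < depthN s × parentN s ≡ t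

  up-child : ∀ {R} → Unbounded R → ∀ t → Up R (node t) → UpChild R t
  up-child {R} unb t upt with unb (suc (height (node t)))
  ... | t″ , h , up″ = s , up-lower (⊑N⇒⊑ s⊑t″) up″ , d ,
    sym (NodeTree.⊑-height-≡ t⊑parent (suc-injective
      (trans (sym e) (sym (proj₂ (stepN s tt d))))))
    where
    t⊑t″ : t NodeTree.⊑ t″
    t⊑t″ = ⊑⇒⊑N (⊑-of-comparable (up-comparable upt up″) (<⇒≤ h))

    ancestor : Σ N λ s → s NodeTree.⊑ t″ × depthN s ≡ suc (depthN t)
    ancestor = NodeTree.ancestorAt tt (NodeTree.⊑-height-< t⊑t″
      λ t≡t″ → <⇒≢ h (cong (λ x → height (node x)) t≡t″))

    s = proj₁ ancestor
    s⊑t″ = proj₁ (proj₂ ancestor)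
    e = proj₂ (proj₂ ancestor)

    t⊏s : 0 < depthN s × t NodeTree.⊑ parentN s
    t⊏s = NodeTree.⊑-parent
      (NodeTree.⊑-of-comparable (NodeTree.⊑-comparable t⊑t″ s⊑t″)
        (≤-trans (n≤1+n _) (≤-reflexive (sym e))))
      (λ t≡s → 1+n≢n (trans (sym e) (cong depthN (sym t≡s))))

    d = proj₁ t⊏s
    t⊑parent = proj₂ t⊏s

  module NodeBranch (t : ℕ → N) (t-root : depthN (t 0) ≡ 0)
    (t-step : ∀ k → 0 < depthN (t (suc k)) × parentN (t (suc k)) ≡ t k) where

    t-depth : ∀ k → depthN (t k) ≡ k
    t-depth zero    = t-root
    t-depth (suc k) = let d , e = t-step k in
      trans (sym (proj₂ (stepN (t (suc k)) tt d))) (cong suc (trans (cong depthN e) (t-depth k)))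

    η : NodeGraph.Ray
    η = NodeGraph.mkRay t
      (λ m n e → trans (sym (t-depth m)) (trans (cong depthN e) (t-depth n)))
      (λ k → inj₁ (t-step k))

    η-corresponds : ∀ R → (∀ k → Up R (node (t k))) → CorrespondsTo G D R η
    η-corresponds R up = corresponds R η λ n →
      n , ≤-refl , ≤-reflexive (sym (t-depth n)) , up n

  tree-ray : ∀ R → Ψ R → Σ NodeGraph.Ray λ η → CorrespondsTo G D R η
  tree-ray R ψ = η , η-corresponds R λ k → proj₂ (seq k)
    where
    child : ∀ t → Up R (node t) → UpChild R t
    child = up-child (Ψ⇒unbounded {R} ψ)

    seq : ∀ k → Σ N λ t → Up R (node t)
    seq zero    = rootN , up-root
    seq (suc k) = let s , up , _ = child (proj₁ (seq k)) (proj₂ (seq k)) in s , up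

    open NodeBranch (λ k → proj₁ (seq k)) depth-root
      (λ k → proj₂ (proj₂ (child (proj₁ (seq k)) (proj₂ (seq k)))))

  -- It suffices that `R₂` has tails in the high selected cones of `R₁`. For such a cone `η₁` must
  -- run above `t`, since otherwise `R₁` would point down; equivalence passes this on to `η₂`, and
  -- `c₂` to `R₂`.
  tree-ray-injective : ∀ R₁ R₂ η₁ η₂ → Ψ R₁ → Ψ R₂ →
    CorrespondsTo G D R₁ η₁ → CorrespondsTo G D R₂ η₂ →
    NodeGraph.RayEquiv η₁ η₂ → RayEquiv R₁ R₂
  tree-ray-injective R₁ R₂ η₁ η₂ ψ₁ _ c₁ c₂ η~ = equiv-of-cones λ n →
    -- The successor excludes the root, which has no edge below it.
    let t , h , up = Ψ⇒unbounded {R₁} ψ₁ (suc n)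
    in node t , <⇒≤ h , up , shared t h up
    where
    shared : ∀ t {n} → n < height (node t) → Up R₁ (node t) → Up R₂ (node t)
    shared t h up = up₂ (NodeSide.dichotomy t η₁)
      where
      d : 0 < depthN t
      d = n≢0⇒n>0 λ e → <⇒≢ (≤-trans (s≤s z≤n) h)
        (sym (trans (cong (λ s → height (node s)) (depthN-0 t e)) root-h))
      up₂ : _ → Up R₂ (node t)
      up₂ (inj₁ above) = pointsUp⇒ t (proj₁ (c₂ t d) (NodeSide.transfer t {η₁} {η₂} η~ above))
      up₂ (inj₂ (m , beside)) = ⊥-elim (pointsDown⇒ t
        (proj₂ (c₁ t d) (m , λ k m≤k → proj₁ (beside k m≤k))) up)

  -- A ray of the decomposition tree descends only finitely often and then ascends forever. The
  -- branch of the normal tree through its later nodes is the ray sought.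
  tree-ray-surjective : ∀ η → Σ Ray λ R → Ψ R × CorrespondsTo G D R η
  tree-ray-surjective η = ray , unbounded⇒Ψ {ray} (λ n → c n , height-c n , up-c n) ,
    corresponds ray η λ n → n + turn , m≤m+n n turn , depth-c n , up-c n
    where
    open NodeGraph using (at; inj; adj)
    Ascent : ℕ → Set
    Ascent n = 0 < depthN (at η (suc n)) × parentN (at η (suc n)) ≡ at η n

    -- Turning back after an ascent would revisit the node it started from, against injectivity.
    ascent-persists : ∀ n → Ascent n → Ascent (suc n)
    ascent-persists n (d , e) with adj η (suc n)
    ... | inj₁ a = a
    ... | inj₂ (_ , e') = ⊥-elim (<⇒≢ (n≤1+n (suc n)) (inj η _ _ (trans (sym e) e')))

    descent : (∀ n → ¬ Ascent n) → ∀ n → n + depthN (at η n) ≡ depthN (at η 0)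
    descent ¬a zero = refl
    descent ¬a (suc n) with adj η n
    ... | inj₁ a = ⊥-elim (¬a n a)
    ... | inj₂ (d , e) = trans (sym (+-suc n _)) (trans (cong (n +_)
      (trans (cong suc (cong depthN (sym e))) (proj₂ (stepN (at η n) tt d)))) (descent ¬a n))

    turning : Σ ℕ Ascent
    turning = byContradiction λ none →
      1+n≰n (m+n≤o⇒m≤o _ (≤-reflexive
        (descent (λ n a → none (n , a)) (suc (depthN (at η 0))))))

    turn : ℕ
    turn = proj₁ turning

    c : ℕ → N
    c n = at η (n + turn)

    c-ascent : ∀ n → Ascent (n + turn)
    c-ascent n = ≤-step-invariant Ascent turn (proj₂ turning)
      (λ k _ → ascent-persists k) (n + turn) (m≤n+m turn n)

    depth-c : ∀ n → n ≤ depthN (c n)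
    depth-c zero    = z≤n
    depth-c (suc n) = let d , e = c-ascent n in
      ≤-trans (s≤s (≤-trans (depth-c n) (≤-reflexive (cong depthN (sym e)))))
        (≤-reflexive (proj₂ (stepN (c (suc n)) tt d)))

    height-c : ∀ n → n ≤ height (node (c n))
    height-c n = ≤-trans (depth-c n) (depth≤height (node (c n)))

    c-mono : ∀ {j k} → j ≤ k → node (c j) ⊑ node (c k)
    c-mono {j} {k} = ≤-step-invariant (λ k → node (c j) ⊑ node (c k)) j
      (⊑-refl (node-In (c j)))
      (λ k _ p → let d , e = c-ascent k in ⊑-trans p
        (subst (λ s → node s ⊑ node (c (suc k))) e (parentN-⊑ (c (suc k)) d))) k

    -- Nodes are at least as high in the normal tree as they are deep, so `c k` has an ancestor at
    -- height `k`. As the `c k` ascend, these ancestors form a branch.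
    below-c : ∀ k → Σ V λ v → v ⊑ node (c k) × height v ≡ k
    below-c k = ancestorAt (node-In (c k)) (height-c k)

    below-⊑ : ∀ {j k} → j ≤ k → proj₁ (below-c j) ⊑ node (c k)
    below-⊑ {j} j≤k = ⊑-trans (proj₁ (proj₂ (below-c j))) (c-mono j≤k)

    open Branch (λ k → proj₁ (below-c k)) (λ k → proj₂ (proj₂ (below-c k)))
      (λ j k → ⊑-comparable (below-⊑ (m≤m⊔n j k)) (below-⊑ (m≤n⊔m j k)))

    up-c : ∀ n → Up ray (node (c n))
    up-c n = eventually (height (node (c n)) , λ m h≤m →
      subst (node (c n) ⊑_) (sym (π-fixes (vertex-In m)))
        (⊑-of-comparable (⊑-comparable (c-mono (m≤m⊔n n m)) (below-⊑ (m≤n⊔m n m)))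
          (≤-trans h≤m (≤-reflexive (sym (proj₂ (proj₂ (below-c m))))))))

  displays : Displays G D Ψ
  displays = tree-ray , lives-at-node , tree-ray-injective , tree-ray-surjective

-- The projection obtained from normality and finite neighbourhoods.

module HighestNeighbour (em : ExcludedMiddle 0ℓ) (G : Graph)
  (connected : GraphNotions.Connected (Graph._~_ G))
  (T : RootedSubtree G) (normal : IsNormal G T)
  (finite : ∀ (C : Graph.V G → Set) →
    GraphNotions.IsComponent (Graph._~_ G) (RootedSubtree.inT T) C →
    GraphNotions.Finite (Graph._~_ G) (GraphNotions.Nbhd (Graph._~_ G) C))
  where
  open Graph G
  open RootedSubtree T hiding (_≤T_)
  open Classical em
  open Walks em _~_ ~-sym
  open NormalTree em G T
  open GraphNotions _~_

  Outside : V → Set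
  Outside v = ¬ inT v

  edge-comp : ∀ {u v} → u ~ v → inT u → inT v → u ⊑ v ⊎ v ⊑ u
  edge-comp {u} {v} e u∈ v∈ = normal u [] v u∈ v∈ [] (e ∷ [-])
    (((λ { refl → ~-irr e }) ∷ []) ∷ [] ∷ [])

  -- The walk shortens to a path from `x` to `y` with no inner vertex in the tree, and normality
  -- compares its ends.
  attachments-comparable : ∀ {x y c d} → inT x → inT y → x ~ c → Outside c →
    Walk Outside c d → d ~ y → x ⊑ y ⊎ y ⊑ x
  attachments-comparable {x} {y} x∈ y∈ e c∉ w e' with em {x ≡ y}
  ... | yes refl = inj₁ (⊑-refl x∈)
  ... | no x≢y with walk⇒linkingPath e c∉ w e' (λ x∉ → x∉ x∈) (λ y∉ → y∉ y∈) x≢y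
  ...   | ms , out , l , u = normal x ms y x∈ y∈ out l u

  Component : V → V → Set
  Component v x = Walk Outside v x

  outside : ∀ {v x} → Outside v → Component v x → Outside x
  outside v∉ w = walk-invariant (λ _ q _ _ → q) w v∉

  component : ∀ {v} → Outside v → IsComponent inT (Component v)
  component {v} v∉ =
    (v , ε) , (λ x → outside v∉) ,
    (λ a b wa wb → walk⇒joined wa (reached wa (walk-rev wa ◅◅ wb))) ,
    (λ u w wu e w∉ → wu ◅◅ ((outside v∉ wu , w∉ , e) ◅ ε))
    where
    reached : ∀ {a b} → Component v a → Walk Outside a b → Walk (Component v) a b
    reached wa ε = ε
    reached wa (s@(_ , _ , e) ◅ w) =
      let wb = wa ◅◅ (s ◅ ε) in (wa , wb , e) ◅ reached wb w

  nbhd-In : ∀ {v x} → Outside v → Nbhd (Component v) x → inT x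
  nbhd-In v∉ (∉C , c , w , e) = byContradiction λ x∉ →
    ∉C (w ◅◅ ((outside v∉ w , x∉ , e) ◅ ε))

  nbhd-comparable : ∀ {v x y} → Outside v → Nbhd (Component v) x → Nbhd (Component v) y →
    x ⊑ y ⊎ y ⊑ x
  nbhd-comparable v∉ nx@(_ , c , w , e) ny@(_ , d , w' , e') =
    attachments-comparable (nbhd-In v∉ nx) (nbhd-In v∉ ny) (~-sym e) (outside v∉ w)
      (walk-rev w ◅◅ w') e'

  -- Connectedness of the graph gives a path from `v` to the root; its first tree vertex is a
  -- neighbour.
  nbhd-nonempty : ∀ {v} → Outside v → Σ V (Nbhd (Component v))
  nbhd-nonempty {v} v∉
    with firstHit {Q = inT} (joined⇒walk (proj₂ connected v root _ _)) v∉ root∈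
  ... | c , d , w , _ , e , _ , d∈ =
    d , (λ w' → outside v∉ w' d∈) , c , walk-map proj₂ w , e

  -- The neighbours form a finite nonempty chain, so one of greatest height is its top.
  highest : ∀ {v} → Outside v →
    Σ V λ x → Nbhd (Component v) x × ∀ y → Nbhd (Component v) y → y ⊑ x
  highest {v} v∉ with nbhd-nonempty v∉ | finite (Component v) (component v∉)
  ... | x₀ , n₀ | xs , fin = x , nx , λ y ny → ⊑-of-comparable (nbhd-comparable v∉ ny nx)
      (All.lookup (f[xs]≤f[argmax] {f = height} x₀ nbrs) (∈-filter⁺ (λ _ → em) (fin y ny) ny))
    where
    -- Finiteness supplies only a list containing the neighbourhood, hence the filter; the known
    -- neighbour `x₀` is the fallback of `argmax`.
    nbrs = filter (λ z → em {Nbhd (Component v) z}) xs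
    x    = argmax height x₀ nbrs
    nx : Nbhd (Component v) x
    nx = argmax-all height {P = Nbhd (Component v)} n₀ (AllP.all-filter (λ z → em) xs)

  π : V → V
  π v with em {inT v}
  ... | yes _ = v
  ... | no v∉ = proj₁ (highest v∉)

  π-fixes : ∀ {v} → inT v → π v ≡ v
  π-fixes {v} v∈ with em {inT v}
  ... | yes _ = refl
  ... | no v∉ = ⊥-elim (v∉ v∈)

  π-nbhd : ∀ {v} → Outside v → Nbhd (Component v) (π v)
  π-nbhd {v} v∉ with em {inT v}
  ... | yes v∈ = ⊥-elim (v∉ v∈)
  ... | no v∉' = proj₁ (proj₂ (highest v∉'))

  π-highest : ∀ {v y} → Outside v → Nbhd (Component v) y → y ⊑ π v
  π-highest {v} v∉ ny with em {inT v}
  ... | yes v∈ = ⊥-elim (v∉ v∈)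
  ... | no v∉' = proj₂ (proj₂ (highest v∉')) _ ny

  π-In : ∀ v → inT (π v)
  π-In v with em {inT v}
  ... | yes v∈ = v∈
  ... | no v∉ = nbhd-In v∉ (proj₁ (proj₂ (highest v∉)))

  -- If `u` is in the tree, it is itself a neighbour of the component of `v`. If not, `u` and `v`
  -- share a component, so the highest neighbour for `u` is one for `v`.
  π-mono : ∀ {u v} → u ~ v → Outside v → π u ⊑ π v
  π-mono {u} {v} e v∉ with em {inT u}
  ... | yes u∈ = π-highest v∉ ((λ w → outside v∉ w u∈) , v , ε , ~-sym e)
  ... | no u∉ = let n@(_ , c , w , e') = proj₁ (proj₂ (highest u∉)) in
    π-highest v∉ ((λ w → outside v∉ w (nbhd-In u∉ n)) , c , (v∉ , u∉ , ~-sym e) ◅ w , e')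

  π-constant : ∀ {v c} → Walk Outside v c → Walk (λ x → π x ≡ π v) v c × π c ≡ π v
  π-constant ε = ε , refl
  π-constant ((a∉ , b∉ , e) ◅ w) =
    let same   = ⊑-antisym (π-mono (~-sym e) a∉) (π-mono e b∉)
        w' , p = π-constant w
    in (refl , same , e) ◅ walk-map (λ q → trans q same) w' , trans p same

  π-walk : ∀ v → Walk (λ x → π x ≡ π v) v (π v)
  π-walk v = go (em {inT v})
    where
    go : Dec (inT v) → Walk (λ x → π x ≡ π v) v (π v)
    go (yes v∈) = subst (Walk _ v) (sym (π-fixes v∈)) ε
    go (no v∉)  = let _ , c , w , e = π-nbhd v∉
                      w' , p        = π-constant w
      in w' ◅◅ ((p , π-fixes (π-In v) , e) ◅ ε)

  projection : Projection
  projection = record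
    { π = π ; π-In = π-In ; π-fixes = π-fixes ; π-mono = π-mono
    ; edge-comp = edge-comp ; π-walk = π-walk }

theorem3p8 : ExcludedMiddle 0ℓ →
    (G : Graph) → GraphNotions.Connected (Graph._~_ G) →
    (T : RootedSubtree G) → IsNormal G T →
    (∀ (C : Graph.V G → Set) →
    GraphNotions.IsComponent (Graph._~_ G) (RootedSubtree.inT T) C →
    GraphNotions.Finite (Graph._~_ G) (GraphNotions.Nbhd (Graph._~_ G) C)) →
    Σ (TreeDecomp G) λ D →
    SepsUpDisjoint G D × SepsFinite G D × SepsConnected G D ×
    Displays G D (λ R → GraphNotions.Undominated (Graph._~_ G) R ×
    GraphNotions.InClosure (Graph._~_ G) (RootedSubtree.inT T) R) ×
    CoversCofinally G D (RootedSubtree.inT T)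
theorem3p8 em G connected T normal finite =
  D , seps-up-disjoint , seps-finite , seps-connected , displays , covers
  where
  open HighestNeighbour em G connected T normal finite using (projection)
  open Decomposition em G T projection
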